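{- Let $S$ be an additively reduced and additively atomic semidomain. The following statements are equivalent: (1) $\mathcal{A}_{+}(S) = S^{\times}$; (2) every $f \in S\llbracket x^{\pm 1} \rrbracket$ with $|\mathrm{supp}(f)| > 1$ can be expressed as the sum of at most three multiplicative irreducibles of $S\llbracket x^{\pm 1} \rrbracket$; (3) there exists a positive integer $k$ such that every $f \in S\llbracket x^{\pm 1}\rrbracket$ with $|\mathrm{supp}(f)| > 1$ can be expressed as the sum of at most $k$ multiplicative irreducibles of $S\llbracket x^{\pm 1} \rrbracket$.
   Context: A semidomain is a subsemiring of an integral domain, i.e., a subset $S$ of an integral domain containing $0$ and $1$ and closed under addition and multiplication. $S^{\times}$ denotes the group of units of the multiplicative monoid $S^* = S\setminus\{0\}$ (elements having a multiplicative inverse in $S$). $\mathcal{A}_{+}(S)$ is the set of atoms of the additive monoid $(S,+)$: elements $a$ that are not additively invertible in $S$ and such that $a = b + c$ with $b, c \in S$ implies that $b$ or $c$ is additively invertible in $S$. $S$ is additively reduced if $0$ is the only invertible element of $(S,+)$. $S$ is additively atomic if every non-invertible element of $(S,+)$ is a sum of finitely many atoms of $(S,+)$. $S\llbracket x^{\pm 1} \rrbracket$ is the semidomain of formal Laurent series with coefficients in $S$ and only finitely many terms with negative exponent; $\mathrm{supp}(f)$ is the set of exponents of $f$ with nonzero coefficient. A multiplicative irreducible of a semidomain $T$ is a nonzero non-unit $a \in T$ such that $a = bc$ with $b, c \in T$ implies $b \in T^{\times}$ or $c \in T^{\times}$. -}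

module Defs where

open import Level using (_⊔_; suc)
open import Algebra.Bundles using (CommutativeRing; CommutativeSemiring; RawSemiring)
open import Data.Fin.Base using (toℕ)
open import Data.Integer.Base as ℤ using (ℤ; -[1+_]; +_; +<+)
open import Data.Integer.Properties as ℤ using ()
open import Data.Nat.Base as ℕ using (ℕ; z≤n)
open import Data.Product.Base using (Σ; ∃; ∃-syntax; _×_; _,_; proj₁)
open import Data.Sum.Base using (_⊎_)
open import Data.Vec.Functional using (Vector)
open import Function.Base using (_on_)
open import Relation.Binary.Construct.On as On using ()
open import Relation.Binary.Core using (Rel)
open import Relation.Binary.PropositionalEquality.Core using (_≢_; subst)
open import Relation.Nullary.Negation.Core using (¬_)
open import Relation.Unary using (Pred; _∈_; _≐_)

import Algebra.Definitions as AlgDefs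
import Algebra.Definitions.RawSemiring as RawSemiringDefs

record IntegralDomain c ℓ : Set (suc (c ⊔ ℓ)) where
  field
    commutativeRing : CommutativeRing c ℓ
  open CommutativeRing commutativeRing public
  field
    1≉0            : ¬ (1# ≈ 0#)
    noZeroDivisors : ∀ {x y} → x * y ≈ 0# → x ≈ 0# ⊎ y ≈ 0#

record Semidomain c ℓ p : Set (suc (c ⊔ ℓ ⊔ p)) where
  field
    integralDomain : IntegralDomain c ℓ
  module R = IntegralDomain integralDomain
  field
    member   : Pred R.Carrier p
    respects : ∀ {x y} → x R.≈ y → x ∈ member → y ∈ member
    0∈       : R.0# ∈ member
    1∈       : R.1# ∈ member
    +-closed : ∀ {x y} → x ∈ member → y ∈ member → x R.+ y ∈ member
    *-closed : ∀ {x y} → x ∈ member → y ∈ member → x R.* y ∈ member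

  -- The subset S as a semiring in its own right; the membership proofs are
  -- irrelevant to its equality.
  commutativeSemiring : CommutativeSemiring (c ⊔ p) ℓ
  commutativeSemiring = record
    { Carrier = ∃ member
    ; _≈_ = R._≈_ on proj₁
    ; _+_ = λ (x , x∈) (y , y∈) → x R.+ y , +-closed x∈ y∈
    ; _*_ = λ (x , x∈) (y , y∈) → x R.* y , *-closed x∈ y∈
    ; 0# = R.0# , 0∈
    ; 1# = R.1# , 1∈
    ; isCommutativeSemiring = record
      { isSemiring = record
        { isSemiringWithoutAnnihilatingZero = record
          { +-isCommutativeMonoid = record
            { isMonoid = record
              { isSemigroup = record
                { isMagma = record
                  { isEquivalence = On.isEquivalence proj₁ R.isEquivalence
                  ; ∙-cong = R.+-cong
                  }
                ; assoc = λ _ _ _ → R.+-assoc _ _ _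
                }
              ; identity = (λ _ → R.+-identityˡ _) , (λ _ → R.+-identityʳ _)
              }
            ; comm = λ _ _ → R.+-comm _ _
            }
          ; *-cong = R.*-cong
          ; *-assoc = λ _ _ _ → R.*-assoc _ _ _
          ; *-identity = (λ _ → R.*-identityˡ _) , (λ _ → R.*-identityʳ _)
          ; distrib = (λ _ _ _ → R.distribˡ _ _ _) , (λ _ _ _ → R.distribʳ _ _ _)
          }
        ; zero = (λ _ → R.zeroˡ _) , (λ _ → R.zeroʳ _)
        }
      ; *-comm = λ _ _ → R.*-comm _ _
      }
    }

  open CommutativeSemiring commutativeSemiring public

module SemiringNotions {a ℓ} (T : RawSemiring a ℓ) where
  open RawSemiring T
  open AlgDefs _≈_ using (Invertible)
  open RawSemiringDefs T public using (sum; _∣_; Irreducible)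

  AdditivelyInvertible : Pred Carrier (a ⊔ ℓ)
  AdditivelyInvertible = Invertible 0# _+_

  -- x ∣ 1# unfolds to ∃ q with q * x ≈ 1#, the form in which the library's
  -- Irreducible expresses being a unit.
  MultiplicativeUnit : Pred Carrier (a ⊔ ℓ)
  MultiplicativeUnit x = x ∣ 1#

  record AdditiveAtom (x : Carrier) : Set (a ⊔ ℓ) where
    field
      notInvertible : ¬ AdditivelyInvertible x
      split         : ∀ {y z} → x ≈ y + z → AdditivelyInvertible y ⊎ AdditivelyInvertible z

  AdditivelyReduced : Set (a ⊔ ℓ)
  AdditivelyReduced = ∀ x → AdditivelyInvertible x → x ≈ 0#

  AdditivelyAtomic : Set (a ⊔ ℓ)
  AdditivelyAtomic = ∀ x → ¬ AdditivelyInvertible x →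
    ∃[ n ] Σ (Vector Carrier n) λ as → (∀ i → AdditiveAtom (as i)) × x ≈ sum as

  MultiplicativeIrreducible : Pred Carrier (a ⊔ ℓ)
  MultiplicativeIrreducible x = x ≉ 0# × Irreducible x

  SumOfAtMost_Irreducibles : ℕ → Pred Carrier (a ⊔ ℓ)
  SumOfAtMost k Irreducibles x =
    ∃[ n ] n ℕ.≤ k × Σ (Vector Carrier n) λ hs → (∀ i → MultiplicativeIrreducible (hs i)) × x ≈ sum hs

module Laurent {a ℓ} (S : CommutativeSemiring a ℓ) where
  private module S = CommutativeSemiring S
  open RawSemiringDefs S.rawSemiring using (sum)

  -- bound is any lower bound of the support, not necessarily the order.
  record LaurentSeries : Set (a ⊔ ℓ) where
    field
      coeff    : ℤ → S.Carrier
      bound    : ℤ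
      vanishes : ∀ n → n ℤ.< bound → coeff n S.≈ S.0#

  open LaurentSeries public

  -- Equality ignores the chosen bounds.
  _≋_ : Rel LaurentSeries ℓ
  f ≋ g = ∀ n → coeff f n S.≈ coeff g n

  0ᴸ : LaurentSeries
  0ᴸ = record { coeff = λ _ → S.0# ; bound = + 0 ; vanishes = λ _ _ → S.refl }

  1ᴸ : LaurentSeries
  1ᴸ = record { coeff = δ ; bound = + 0 ; vanishes = δ-vanishes }
    where
    δ : ℤ → S.Carrier
    δ (+ 0) = S.1#
    δ _     = S.0#
    δ-vanishes : ∀ n → n ℤ.< + 0 → δ n S.≈ S.0#
    δ-vanishes (+ _)    (+<+ ())
    δ-vanishes -[1+ _ ] _ = S.refl

  _+ᴸ_ : LaurentSeries → LaurentSeries → LaurentSeries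
  f +ᴸ g = record
    { coeff    = λ n → coeff f n S.+ coeff g n
    ; bound    = bound f ℤ.⊓ bound g
    ; vanishes = λ n n<b → S.trans
        (S.+-cong (vanishes f n (ℤ.<-≤-trans n<b (ℤ.i⊓j≤i (bound f) (bound g))))
                  (vanishes g n (ℤ.<-≤-trans n<b (ℤ.i⊓j≤j (bound f) (bound g)))))
        (S.+-identityˡ S.0#)
    }

  -- convolution f g d is the coefficient of f g in degree
  -- bound f + bound g + d: only the pairs of degrees (bound f + k, bound g + (d - k))
  -- with 0 ≤ k ≤ d can contribute, the others having a vanishing factor.
  convolution : LaurentSeries → LaurentSeries → ℤ → S.Carrier
  convolution f g (+ d)    = sum {ℕ.suc d} λ k →
    coeff f (bound f ℤ.+ + toℕ k) S.* coeff g (bound g ℤ.+ + (d ℕ.∸ toℕ k))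
  convolution f g -[1+ _ ] = S.0#

  _*ᴸ_ : LaurentSeries → LaurentSeries → LaurentSeries
  f *ᴸ g = record
    { coeff    = λ n → convolution f g (n ℤ.- b)
    ; bound    = b
    ; vanishes = λ n n<b → negative (n ℤ.- b)
        (subst (n ℤ.- b ℤ.<_) (ℤ.+-inverseʳ b) (ℤ.+-monoˡ-< (ℤ.- b) n<b))
    }
    where
    b : ℤ
    b = bound f ℤ.+ bound g
    negative : ∀ d → d ℤ.< + 0 → convolution f g d S.≈ S.0#
    negative (+ _)    (+<+ ())
    negative -[1+ _ ] _ = S.refl

  rawSemiring : RawSemiring (a ⊔ ℓ) ℓ
  rawSemiring = record
    { Carrier = LaurentSeries
    ; _≈_ = _≋_
    ; _+_ = _+ᴸ_
    ; _*_ = _*ᴸ_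
    ; 0# = 0ᴸ
    ; 1# = 1ᴸ
    }

  supp : LaurentSeries → Pred ℤ ℓ
  supp f n = ¬ (coeff f n S.≈ S.0#)

  ∣supp∣>1 : Pred LaurentSeries ℓ
  ∣supp∣>1 f = ∃[ i ] ∃[ j ] i ≢ j × i ∈ supp f × j ∈ supp f

module _ {c ℓ p} (S : Semidomain c ℓ p) where
  private
    module S    = SemiringNotions (Semidomain.rawSemiring S)
    module L    = Laurent (Semidomain.commutativeSemiring S)
    module S⟦x⟧ = SemiringNotions L.rawSemiring

  IsAdditivelyReduced : Set (c ⊔ ℓ ⊔ p)
  IsAdditivelyReduced = S.AdditivelyReduced

  IsAdditivelyAtomic : Set (c ⊔ ℓ ⊔ p)
  IsAdditivelyAtomic = S.AdditivelyAtomic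

  AtomsEqualUnits : Set (c ⊔ ℓ ⊔ p)
  AtomsEqualUnits = S.AdditiveAtom ≐ S.MultiplicativeUnit

  EverySeriesSumOfAtMost : ℕ → Set (c ⊔ ℓ ⊔ p)
  EverySeriesSumOfAtMost k =
    ∀ f → L.∣supp∣>1 f → S⟦x⟧.SumOfAtMost k Irreducibles f

{-# OPTIONS --safe #-}

-- Suppose every atom is a unit.  A Laurent series with an atom among its coefficients is irreducible if its support
-- contains l ≠ m such that, for exponents s, t ≠ l of the support, neither s + t = m + l nor m + s = l + t: if it is a
-- product of h and k, neither of them monomial, then supp h + supp k contains such s and t, as positive coefficients
-- do not cancel.  Let f have order 0.  If supp f is infinite, rescale the exponents so that some b in it is odd.
-- A unit taken from f₀ with the odd part of f is irreducible, and so is a unit times x^b with the even part beyond b,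
-- since the exponents, counted from the lowest one, are sum-free; the remaining polynomial becomes irreducible after
-- adding a single far away term.  If f is a polynomial of degree M, cut at the exponent M/2 instead, with a third
-- summand for the coefficient at M/2.
-- Conversely, if a is an atom and a (1 + x + x² + ⋯) is a sum of finitely many irreducibles, every coefficient a comes
-- from exactly one of them.  By the pigeonhole principle one summand is a times a series with at least two terms, so
-- a is a unit.
module Submission where

open import Defs
open import Level using (Level; _⊔_; Lift; lift; lower)
open import Algebra.Bundles using (CommutativeSemiring)
open import Algebra.Definitions.RawMagma using (_,_)
open import Axiom.ExcludedMiddle using (ExcludedMiddle)
open import Data.Empty using (⊥; ⊥-elim)
open import Data.Fin.Base as Fin using (Fin; toℕ; fromℕ<; punchOut)
open import Data.Fin.Properties as Fin using (toℕ-fromℕ<; toℕ<n; punchIn-punchOut; punchInᵢ≢i)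
open import Data.Integer.Base as ℤ using (ℤ; -[1+_]; +_; +<+)
open import Data.Integer.Properties as ℤ using ()
open import Data.Integer.Tactic.RingSolver using (solve-∀)
open import Data.Nat.Base as ℕ using (ℕ; _<_; s≤s)
open import Data.Nat.Divisibility as ℕ using (_∣_; _∣?_; divides)
open import Data.Nat.Induction as ℕ using ()
open import Data.Nat.Properties as ℕ using ()
open import Data.Nat.Tactic.RingSolver as ℕ using ()
open import Data.Product.Base using (∃-syntax; _×_; _,_; proj₁; proj₂)
open import Data.Sum.Base using (_⊎_; inj₁; inj₂; [_,_]′)
open import Data.Vec.Functional using (Vector; removeAt; _∷_; [])
open import Function.Base using (_∘_)
open import Function.Bundles using (_⇔_; mk⇔)
open import Induction.WellFounded using (Acc; acc)
open import Relation.Binary.PropositionalEquality as ≡ using (_≡_; _≢_; cong; cong₂; subst; subst₂)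
open import Relation.Nullary using (¬_; Dec; yes; no; contradiction)
open import Relation.Nullary.Decidable using (¬?; decidable-stable; map′; toSum)
open import Relation.Unary using (_≐_)
import Algebra.Properties.AbelianGroup ℤ.+-0-abelianGroup as ℤ+
import Algebra.Properties.CommutativeMonoid.Sum as MonoidSum
import Algebra.Properties.CommutativeSemigroup as CommutativeSemigroupProperties
import Algebra.Solver.CommutativeMonoid as MonoidSolver

module Reduced {a ℓ} (T : CommutativeSemiring a ℓ) (em : ExcludedMiddle ℓ)
  (reduced : SemiringNotions.AdditivelyReduced (CommutativeSemiring.rawSemiring T))
  (1≉0 : ¬ CommutativeSemiring._≈_ T (CommutativeSemiring.1# T) (CommutativeSemiring.0# T))
  (noZeroDivisors : ∀ {x y} → CommutativeSemiring._≈_ T (CommutativeSemiring._*_ T x y) (CommutativeSemiring.0# T) →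
     CommutativeSemiring._≈_ T x (CommutativeSemiring.0# T) ⊎ CommutativeSemiring._≈_ T y (CommutativeSemiring.0# T))
  where

  open CommutativeSemiring T hiding (zero)
  open SemiringNotions rawSemiring hiding (_∣_)
  open MonoidSum +-commutativeMonoid using (sum-remove; sum-cong-≋; sum-replicate-zero)
  open CommutativeSemigroupProperties +-commutativeSemigroup using (x∙yz≈y∙xz)
  module S⟦x⟧ = SemiringNotions (Laurent.rawSemiring T)
  module MS = MonoidSolver +-commutativeMonoid
  open Laurent T hiding (rawSemiring; supp)

  +≈0⇒ˡ : ∀ {x y} → x + y ≈ 0# → x ≈ 0#
  +≈0⇒ˡ {x} {y} eq = reduced x (y , trans (+-comm y x) eq , eq)

  +≈0⇒ʳ : ∀ {x y} → x + y ≈ 0# → y ≈ 0#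
  +≈0⇒ʳ eq = +≈0⇒ˡ (trans (+-comm _ _) eq)

  *≉0 : ∀ {x y} → x ≉ 0# → y ≉ 0# → x * y ≉ 0#
  *≉0 x≉0 y≉0 = [ x≉0 , y≉0 ]′ ∘ noZeroDivisors

  *≉0⇒ˡ : ∀ {x y} → x * y ≉ 0# → x ≉ 0#
  *≉0⇒ˡ xy≉0 x≈0 = xy≉0 (trans (*-congʳ x≈0) (zeroˡ _))

  *≉0⇒ʳ : ∀ {x y} → x * y ≉ 0# → y ≉ 0#
  *≉0⇒ʳ xy≉0 y≈0 = xy≉0 (trans (*-congˡ y≈0) (zeroʳ _))

  ≉-resp : ∀ {x y} → x ≈ y → x ≉ 0# → y ≉ 0#
  ≉-resp x≈y x≉0 y≈0 = x≉0 (trans x≈y y≈0)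

  ≉-resp-≡ : ∀ {x y} → x ≡ y → x ≉ 0# → y ≉ 0#
  ≉-resp-≡ eq = subst (_≉ 0#) eq

  stable : ∀ {x} → ¬ x ≉ 0# → x ≈ 0#
  stable {x} ¬¬ with em {x ≈ 0#}
  ... | yes x≈0 = x≈0
  ... | no x≉0 = contradiction x≉0 ¬¬

  0-invertible : ∀ {x} → x ≈ 0# → AdditivelyInvertible x
  0-invertible x≈0 = 0# , trans (+-identityˡ _) x≈0 , trans (+-identityʳ _) x≈0

  atom≉0 : ∀ {x} → AdditiveAtom x → x ≉ 0#
  atom≉0 at x≈0 = AdditiveAtom.notInvertible at (0-invertible x≈0)

  atom-split : ∀ {x y z} → AdditiveAtom x → x ≈ y + z → y ≈ 0# ⊎ z ≈ 0#
  atom-split at eq with AdditiveAtom.split at eq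
  ... | inj₁ y = inj₁ (reduced _ y)
  ... | inj₂ z = inj₂ (reduced _ z)

  mkAtom : ∀ {x} → x ≉ 0# → (∀ {y z} → x ≈ y + z → y ≈ 0# ⊎ z ≈ 0#) → AdditiveAtom x
  mkAtom x≉0 split = record
    { notInvertible = x≉0 ∘ reduced _
    ; split = [ inj₁ ∘ 0-invertible , inj₂ ∘ 0-invertible ]′ ∘ split
    }

  atom-resp : ∀ {x y} → x ≈ y → AdditiveAtom x → AdditiveAtom y
  atom-resp x≈y at = mkAtom (≉-resp x≈y (atom≉0 at)) (λ eq → atom-split at (trans x≈y eq))

  sum≉0⇒ : ∀ {n} (v : Vector Carrier n) → sum v ≉ 0# → ∃[ i ] v i ≉ 0#
  sum≉0⇒ {ℕ.zero} v Σ≉0 = contradiction refl Σ≉0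
  sum≉0⇒ {ℕ.suc n} v Σ≉0 with em {v Fin.zero ≈ 0#}
  ... | no v₀≉0 = Fin.zero , v₀≉0
  ... | yes v₀≈0
    with i , vᵢ≉0 ← sum≉0⇒ (v ∘ Fin.suc) (Σ≉0 ∘ λ eq → trans (+-cong v₀≈0 eq) (+-identityˡ 0#)) = Fin.suc i , vᵢ≉0

  ⇒sum≉0 : ∀ {n} (v : Vector Carrier n) {i} → v i ≉ 0# → sum v ≉ 0#
  ⇒sum≉0 {ℕ.suc n} v {i} vᵢ≉0 eq = vᵢ≉0 (+≈0⇒ˡ (trans (sym (sum-remove v)) eq))

  sum-single : ∀ {n} (v : Vector Carrier n) i → (∀ j → j ≢ i → v j ≈ 0#) → sum v ≈ v i
  sum-single {ℕ.suc n} v i others = trans (sum-remove {i = i} v)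
    (trans (+-congˡ (trans (sum-cong-≋ (λ j → others _ (punchInᵢ≢i i j))) (sum-replicate-zero n))) (+-identityʳ _))

  sum-atom-unique : ∀ {n} (v : Vector Carrier n) {i j} → AdditiveAtom (sum v) → v i ≉ 0# → v j ≉ 0# → i ≡ j
  sum-atom-unique {ℕ.suc n} v {i} {j} at vᵢ≉0 vⱼ≉0 with i Fin.≟ j
  ... | yes i≡j = i≡j
  ... | no i≢j with atom-split at (sum-remove {i = i} v)
  ...   | inj₁ vᵢ≈0 = contradiction vᵢ≈0 vᵢ≉0
  ...   | inj₂ rest≈0 = contradiction rest≈0
    (⇒sum≉0 (removeAt v i) {punchOut i≢j} (≉-resp-≡ (cong v (≡.sym (punchIn-punchOut i≢j))) vⱼ≉0))

  sum-atom : ∀ {n} (v : Vector Carrier n) {i} → AdditiveAtom (sum v) → v i ≉ 0# → sum v ≈ v i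
  sum-atom v {i} at vᵢ≉0 = sum-single v i λ j j≢i → stable λ vⱼ≉0 → j≢i (sum-atom-unique v at vⱼ≉0 vᵢ≉0)

  above : ∀ h {i} → coeff h i ≉ 0# → ∃[ p ] i ≡ bound h ℤ.+ + p
  above h {i} hᵢ≉0 = ℤ.∣ i ℤ.- bound h ∣ ,
    ≡.trans (shift i (bound h)) (cong (ℤ._+_ (bound h)) (≡.sym (ℤ.0≤i⇒+∣i∣≡i
      (subst (ℤ._≤ i ℤ.- bound h) (ℤ.+-inverseʳ (bound h)) (ℤ.+-monoˡ-≤ (ℤ.- bound h) b≤i)))))
    where
    b≤i = ℤ.≮⇒≥ (hᵢ≉0 ∘ vanishes h i)
    shift : ∀ x y → x ≡ y ℤ.+ (x ℤ.- y)
    shift = solve-∀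

  term : LaurentSeries → LaurentSeries → ∀ d → Vector Carrier (ℕ.suc d)
  term h k d κ = coeff h (bound h ℤ.+ + toℕ κ) * coeff k (bound k ℤ.+ + (d ℕ.∸ toℕ κ))

  degree-sum : ∀ b c x y → b ℤ.+ x ℤ.+ (c ℤ.+ y) ≡ b ℤ.+ c ℤ.+ (x ℤ.+ y)
  degree-sum = solve-∀

  term-degree : ∀ h k d (κ : Fin (ℕ.suc d)) →
    bound h ℤ.+ + toℕ κ ℤ.+ (bound k ℤ.+ + (d ℕ.∸ toℕ κ)) ≡ bound h ℤ.+ bound k ℤ.+ + d
  term-degree h k d κ = ≡.trans (degree-sum (bound h) (bound k) (+ toℕ κ) (+ (d ℕ.∸ toℕ κ)))
    (cong (λ e → bound h ℤ.+ bound k ℤ.+ + e) (ℕ.m+[n∸m]≡n (ℕ.≤-pred (toℕ<n κ))))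

  coeff-* : ∀ h k {i j} p q → i ≡ bound h ℤ.+ + p → j ≡ bound k ℤ.+ + q →
    coeff (h *ᴸ k) (i ℤ.+ j) ≡ sum (term h k (p ℕ.+ q))
  coeff-* h k p q ≡.refl ≡.refl = cong (convolution h k) (eq (bound h) (bound k) (+ p) (+ q))
    where
    eq : ∀ b c x y → b ℤ.+ x ℤ.+ (c ℤ.+ y) ℤ.- (b ℤ.+ c) ≡ x ℤ.+ y
    eq = solve-∀

  index : ∀ p q → Fin (ℕ.suc (p ℕ.+ q))
  index p q = fromℕ< (s≤s (ℕ.m≤m+n p q))

  toℕ-index : ∀ p q → toℕ (index p q) ≡ p
  toℕ-index p q = toℕ-fromℕ< _

  term-index : ∀ h k {i j} p q → i ≡ bound h ℤ.+ + p → j ≡ bound k ℤ.+ + q →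
    term h k (p ℕ.+ q) (index p q) ≡ coeff h i * coeff k j
  term-index h k p q ≡.refl ≡.refl rewrite toℕ-index p q | ℕ.m+n∸m≡n p q = ≡.refl

  *-supp⁺ : ∀ h k {i j} → coeff h i ≉ 0# → coeff k j ≉ 0# → coeff (h *ᴸ k) (i ℤ.+ j) ≉ 0#
  *-supp⁺ h k hᵢ≉0 kⱼ≉0 with p , i≡ ← above h hᵢ≉0 | q , j≡ ← above k kⱼ≉0 =
    ≉-resp-≡ (≡.sym (coeff-* h k p q i≡ j≡))
      (⇒sum≉0 (term h k (p ℕ.+ q)) {index p q} (≉-resp-≡ (≡.sym (term-index h k p q i≡ j≡)) (*≉0 hᵢ≉0 kⱼ≉0)))

  *-supp⁻ : ∀ h k {n} → coeff (h *ᴸ k) n ≉ 0# →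
    ∃[ i ] ∃[ j ] i ℤ.+ j ≡ n × coeff h i * coeff k j ≉ 0# ×
      (AdditiveAtom (coeff (h *ᴸ k) n) → coeff (h *ᴸ k) n ≈ coeff h i * coeff k j)
  *-supp⁻ h k {n} ≉0 = go (n ℤ.- b) ≡.refl ≉0
    where
    b = bound h ℤ.+ bound k
    go : ∀ d → n ℤ.- b ≡ d → convolution h k d ≉ 0# → ∃[ i ] ∃[ j ] i ℤ.+ j ≡ n × coeff h i * coeff k j ≉ 0#
           × (AdditiveAtom (convolution h k d) → convolution h k d ≈ coeff h i * coeff k j)
    go -[1+ _ ] _ ≉0 = contradiction refl ≉0
    go (+ d) n-b≡d ≉0 with κ , κ≉0 ← sum≉0⇒ (term h k d) ≉0 =
      _ , _ , ≡.trans (term-degree h k d κ) (≡.trans (cong (ℤ._+_ b) (≡.sym n-b≡d)) (cancel b n))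
      , κ≉0 , λ at → sum-atom (term h k d) at κ≉0
      where
      cancel : ∀ b n → b ℤ.+ (n ℤ.- b) ≡ n
      cancel = solve-∀

  *-atom-unique : ∀ h k {i j i′ j′} → i ℤ.+ j ≡ i′ ℤ.+ j′ → AdditiveAtom (coeff (h *ᴸ k) (i ℤ.+ j)) →
    coeff h i ≉ 0# → coeff k j ≉ 0# → coeff h i′ ≉ 0# → coeff k j′ ≉ 0# → i ≡ i′
  *-atom-unique h k {i} {j} {i′} {j′} eq at hᵢ kⱼ hᵢ′ kⱼ′
    with p , i≡ ← above h hᵢ | q , j≡ ← above k kⱼ | p′ , i′≡ ← above h hᵢ′ | q′ , j′≡ ← above k kⱼ′ =
    ≡.trans i≡ (≡.trans (cong (λ x → bound h ℤ.+ + x) p≡p′) (≡.sym i′≡))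
    where
    v = term h k (p ℕ.+ q)
    sum≡ : p ℕ.+ q ≡ p′ ℕ.+ q′
    sum≡ = ℤ.+-injective (ℤ+.∙-cancelˡ (bound h ℤ.+ bound k) (+ (p ℕ.+ q)) (+ (p′ ℕ.+ q′))
      (≡.trans (≡.sym (degree-sum (bound h) (bound k) (+ p) (+ q))) (≡.trans (≡.sym (cong₂ ℤ._+_ i≡ j≡))
        (≡.trans eq (≡.trans (cong₂ ℤ._+_ i′≡ j′≡) (degree-sum (bound h) (bound k) (+ p′) (+ q′)))))))
    p′< : p′ ℕ.< ℕ.suc (p ℕ.+ q)
    p′< = s≤s (subst (p′ ℕ.≤_) (≡.sym sum≡) (ℕ.m≤m+n p′ q′))
    v′≡ : v (fromℕ< p′<) ≡ coeff h i′ * coeff k j′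
    v′≡ rewrite toℕ-fromℕ< p′< | sum≡ | ℕ.m+n∸m≡n p′ q′ | i′≡ | j′≡ = ≡.refl
    p≡p′ : p ≡ p′
    p≡p′ = ≡.trans (≡.sym (toℕ-index p q)) (≡.trans (cong toℕ (sum-atom-unique v
      (subst AdditiveAtom (coeff-* h k p q i≡ j≡) at)
      (≉-resp-≡ (≡.sym (term-index h k p q i≡ j≡)) (*≉0 hᵢ kⱼ))
      (≉-resp-≡ (≡.sym v′≡) (*≉0 hᵢ′ kⱼ′)))) (toℕ-fromℕ< p′<))

  MonomialAt : ℤ → LaurentSeries → Set ℓ
  MonomialAt l h = ∀ i → i ≢ l → coeff h i ≈ 0#

  *-unique-pair : ∀ h k i j → (∀ i′ j′ → i′ ℤ.+ j′ ≡ i ℤ.+ j → i′ ≢ i → coeff h i′ * coeff k j′ ≈ 0#) →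
    coeff (h *ᴸ k) (i ℤ.+ j) ≈ coeff h i * coeff k j
  *-unique-pair h k i j others with em {coeff h i * coeff k j ≈ 0#}
  ... | yes ≈0 = trans (stable λ ≉0 → absurd ≉0) (sym ≈0)
    where
    absurd : coeff (h *ᴸ k) (i ℤ.+ j) ≉ 0# → ⊥
    absurd ≉0 with i′ , j′ , eq , hk≉0 , _ ← *-supp⁻ h k ≉0 with i′ ℤ.≟ i
    ... | no i′≢i = hk≉0 (others i′ j′ eq i′≢i)
    ... | yes ≡.refl with ≡.refl ← ℤ+.∙-cancelˡ i′ j′ j eq = hk≉0 ≈0
  ... | no ≉0 with p , i≡ ← above h (*≉0⇒ˡ ≉0) | q , j≡ ← above k (*≉0⇒ʳ ≉0) =
    trans (reflexive (coeff-* h k p q i≡ j≡))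
      (trans (sum-single (term h k (p ℕ.+ q)) (index p q) vanish) (reflexive (term-index h k p q i≡ j≡)))
    where
    vanish : ∀ κ → κ ≢ index p q → term h k (p ℕ.+ q) κ ≈ 0#
    vanish κ κ≢ = others _ _ (≡.trans (term-degree h k (p ℕ.+ q) κ)
        (≡.trans (≡.sym (degree-sum (bound h) (bound k) (+ p) (+ q))) (≡.sym (cong₂ ℤ._+_ i≡ j≡))))
      λ eq → κ≢ (Fin.toℕ-injective (≡.trans
        (ℤ.+-injective (ℤ+.∙-cancelˡ (bound h) (+ toℕ κ) (+ p) (≡.trans eq i≡))) (≡.sym (toℕ-index p q))))

  monomial-* : ∀ h k {l} → MonomialAt l h → ∀ j → coeff (h *ᴸ k) (l ℤ.+ j) ≈ coeff h l * coeff k j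
  monomial-* h k {l} mono j = *-unique-pair h k l j λ i′ _ _ i′≢l → trans (*-congʳ (mono i′ i′≢l)) (zeroˡ _)

  *-monomial : ∀ h k {l} → MonomialAt l k → ∀ i → coeff (h *ᴸ k) (i ℤ.+ l) ≈ coeff h i * coeff k l
  *-monomial h k {l} mono i = *-unique-pair h k i l λ i′ j′ eq i′≢i →
    trans (*-congˡ (mono j′ λ { ≡.refl → i′≢i (ℤ+.∙-cancelʳ l i′ i eq) })) (zeroʳ _)

  coeff-1 : ∀ {n} → coeff 1ᴸ n ≉ 0# → n ≡ + 0
  coeff-1 {+ 0} _ = ≡.refl
  coeff-1 {+ (ℕ.suc n)} ≉0 = contradiction refl ≉0
  coeff-1 { -[1+ n ]} ≉0 = contradiction refl ≉0

  ≋1-supp : ∀ {f n} → f ≋ 1ᴸ → coeff f n ≉ 0# → n ≡ + 0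
  ≋1-supp f≋1 fₙ≉0 = coeff-1 (≉-resp (f≋1 _) fₙ≉0)

  unit-supp : ∀ {h} → S⟦x⟧.MultiplicativeUnit h → ∀ {i j} → coeff h i ≉ 0# → coeff h j ≉ 0# → i ≡ j
  unit-supp {h} (q , qh≋1) {i} {j} hᵢ hⱼ
    with k , _ , _ , qh≉0 , _ ← *-supp⁻ q h {+ 0} (≉-resp (sym (qh≋1 (+ 0))) 1≉0) =
    ℤ+.∙-cancelˡ k i j (≡.trans (at0 hᵢ) (≡.sym (at0 hⱼ)))
    where
    at0 : ∀ {i} → coeff h i ≉ 0# → k ℤ.+ i ≡ + 0
    at0 hᵢ = ≋1-supp {q *ᴸ h} qh≋1 (*-supp⁺ q h (*≉0⇒ˡ qh≉0) hᵢ)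

  module Series (a : ℤ) (φ : ℕ → Carrier) where
    extend : ℤ → Carrier
    extend (+ k) = φ k
    extend -[1+ _ ] = 0#
    negative : ∀ d → d ℤ.< + 0 → extend d ≈ 0#
    negative (+ _)    (+<+ ())
    negative -[1+ _ ] _ = refl

    series : LaurentSeries
    series = record
      { coeff = λ n → extend (n ℤ.- a)
      ; bound = a
      ; vanishes = λ n n<a → negative (n ℤ.- a)
          (subst (n ℤ.- a ℤ.<_) (ℤ.+-inverseʳ a) (ℤ.+-monoˡ-< (ℤ.- a) n<a))
      }

  open Series using (series)

  coeff-sum : ∀ {n} (hs : Vector LaurentSeries n) d → coeff (S⟦x⟧.sum hs) d ≡ sum (λ i → coeff (hs i) d)
  coeff-sum {ℕ.zero} hs d = ≡.refl
  coeff-sum {ℕ.suc n} hs d = cong (λ y → coeff (hs Fin.zero) d + y) (coeff-sum (hs ∘ Fin.suc) d)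

  coeff-series : ∀ a φ k → coeff (series a φ) (a ℤ.+ + k) ≡ φ k
  coeff-series a φ k = cong extend (eq a (+ k))
    where
    open Series a φ
    eq : ∀ x y → x ℤ.+ y ℤ.- x ≡ y
    eq = solve-∀

  supp-series : ∀ a φ {n} → coeff (series a φ) n ≉ 0# → ∃[ k ] n ≡ a ℤ.+ + k × φ k ≉ 0#
  supp-series a φ {n} fₙ≉0 with k , ≡.refl ← above (series a φ) {n} fₙ≉0 =
    k , ≡.refl , ≉-resp-≡ (coeff-series a φ k) fₙ≉0

  unit-monomial : ∀ {h l} → MonomialAt l h → MultiplicativeUnit (coeff h l) → S⟦x⟧.MultiplicativeUnit h
  unit-monomial {h} {l} mono (c , ch≈1) = q , qh≋1
    where
    q = series (ℤ.- l) λ { ℕ.zero → c ; (ℕ.suc _) → 0# }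
    q-mono : MonomialAt (ℤ.- l) q
    q-mono i i≢ = stable λ qᵢ≉0 → contra (supp-series (ℤ.- l) _ qᵢ≉0)
      where
      contra : _ → ⊥
      contra (ℕ.zero , eq , _) = i≢ (≡.trans eq (ℤ.+-identityʳ _))
      contra (ℕ.suc _ , _ , ≉0) = ≉0 refl
    q-lead : coeff q (ℤ.- l) ≈ c
    q-lead = reflexive (≡.trans (cong (coeff q) (≡.sym (ℤ.+-identityʳ (ℤ.- l)))) (coeff-series (ℤ.- l) _ 0))
    eq : ∀ l n → ℤ.- l ℤ.+ (l ℤ.+ n) ≡ n
    eq = solve-∀
    qh : ∀ n → coeff (q *ᴸ h) n ≈ c * coeff h (l ℤ.+ n)
    qh n = trans (reflexive (cong (coeff (q *ᴸ h)) (≡.sym (eq l n))))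
      (trans (monomial-* q h q-mono (l ℤ.+ n)) (*-congʳ q-lead))
    off : ∀ {n} → n ≢ + 0 → coeff (q *ᴸ h) n ≈ 0#
    off n≢0 = trans (qh _) (trans (*-congˡ (mono _ λ eq →
      n≢0 (ℤ+.∙-cancelˡ l _ _ (≡.trans eq (≡.sym (ℤ.+-identityʳ l)))))) (zeroʳ c))
    qh≋1 : (q *ᴸ h) ≋ 1ᴸ
    qh≋1 (+ 0) = trans (qh (+ 0)) (trans (*-congˡ (reflexive (cong (coeff h) (ℤ.+-identityʳ l)))) ch≈1)
    qh≋1 n@(+ (ℕ.suc _)) = off {n} λ ()
    qh≋1 n@(-[1+ _ ]) = off {n} λ ()

  support-pair? : ∀ h i₀ → (∃[ i ] i ≢ i₀ × coeff h i ≉ 0#) ⊎ MonomialAt i₀ h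
  support-pair? h i₀ with em {∃[ i ] i ≢ i₀ × coeff h i ≉ 0#}
  ... | yes other = inj₁ other
  ... | no none = inj₂ λ i i≢ → stable λ hᵢ≉0 → none (i , i≢ , hᵢ≉0)

  module Criterion (atom⇒unit : ∀ {x} → AdditiveAtom x → MultiplicativeUnit x) where

    isolated⇒irreducible : ∀ {g l m n} → coeff g l ≉ 0# → coeff g m ≉ 0# → m ≢ l →
      (∀ {s t} → coeff g s ≉ 0# → coeff g t ≉ 0# → s ≢ l → t ≢ l → s ℤ.+ t ≡ m ℤ.+ l →
        s ≡ t × AdditiveAtom (coeff g s)) →
      (∀ {s t} → coeff g s ≉ 0# → coeff g t ≉ 0# → s ≢ l → m ℤ.+ s ≢ l ℤ.+ t) →
      AdditiveAtom (coeff g n) → S⟦x⟧.MultiplicativeIrreducible g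
    isolated⇒irreducible {g} {l} {m} {n} gₗ gₘ m≢l sums shifts at =
      (λ g≋0 → gₗ (g≋0 l)) ,
      record { p∤1 = λ g∣1 → m≢l (unit-supp {g} g∣1 gₘ gₗ) ; split-∣1 = λ {h} {k} → factor h k }
      where
      factor : ∀ h k → g ≋ (h *ᴸ k) → S⟦x⟧.MultiplicativeUnit h ⊎ S⟦x⟧.MultiplicativeUnit k
      factor h k g≋hk
        with i₀ , j₀ , i₀+j₀≡l , hk₀ , _ ← *-supp⁻ h k {l} (≉-resp (g≋hk l) gₗ)
           | i , j , i+j≡n , hk≉0 , atom≈ ← *-supp⁻ h k {n} (≉-resp (g≋hk n) (atom≉0 at))
           | c , cg≈1 ← atom⇒unit at
        with support-pair? h i₀ | support-pair? k j₀
      ... | inj₂ mono | _ = inj₁ (unit-monomial {h} mono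
        (c * coeff k j , trans (*-assoc _ _ _) (trans (*-congˡ (*-comm _ _)) prod)))
        where
        i≡i₀ : i ≡ i₀
        i≡i₀ with i ℤ.≟ i₀
        ... | yes eq = eq
        ... | no i≢ = contradiction (mono i i≢) (*≉0⇒ˡ hk≉0)
        prod : c * (coeff h i₀ * coeff k j) ≈ 1#
        prod = trans (*-congˡ (trans (*-congʳ (reflexive (cong (coeff h) (≡.sym i≡i₀))))
          (sym (trans (g≋hk n) (atom≈ (atom-resp (g≋hk n) at)))))) cg≈1
      ... | inj₁ _ | inj₂ mono = inj₂ (unit-monomial {k} mono (c * coeff h i , trans (*-assoc _ _ _) prod))
        where
        j≡j₀ : j ≡ j₀
        j≡j₀ with j ℤ.≟ j₀
        ... | yes eq = eq
        ... | no j≢ = contradiction (mono j j≢) (*≉0⇒ʳ hk≉0)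
        prod : c * (coeff h i * coeff k j₀) ≈ 1#
        prod = trans (*-congˡ (trans (*-congˡ (reflexive (cong (coeff k) (≡.sym j≡j₀))))
          (sym (trans (g≋hk n) (atom≈ (atom-resp (g≋hk n) at)))))) cg≈1
      ... | inj₁ (i₁ , i₁≢ , hᵢ₁) | inj₁ (j₁ , j₁≢ , kⱼ₁)
        with i₂ , j₂ , i₂+j₂≡m , hk₂ , _ ← *-supp⁻ h k {m} (≉-resp (g≋hk m) gₘ) = ⊥-elim absurd
        where
        h₀ = *≉0⇒ˡ hk₀
        k₀ = *≉0⇒ʳ hk₀
        h₂ = *≉0⇒ˡ hk₂
        k₂ = *≉0⇒ʳ hk₂
        g-supp : ∀ {i j} → coeff h i ≉ 0# → coeff k j ≉ 0# → coeff g (i ℤ.+ j) ≉ 0#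
        g-supp hᵢ kⱼ = ≉-resp (sym (g≋hk _)) (*-supp⁺ h k hᵢ kⱼ)
        ≢ˡ : ∀ {i} → i ≢ i₀ → i ℤ.+ j₀ ≢ l
        ≢ˡ i≢ eq = i≢ (ℤ+.∙-cancelʳ j₀ _ _ (≡.trans eq (≡.sym i₀+j₀≡l)))
        ≢ʳ : ∀ {j} → j ≢ j₀ → i₀ ℤ.+ j ≢ l
        ≢ʳ j≢ eq = j≢ (ℤ+.∙-cancelˡ i₀ _ _ (≡.trans eq (≡.sym i₀+j₀≡l)))
        eq₁ : ∀ x y z w → x ℤ.+ y ℤ.+ (z ℤ.+ w) ≡ z ℤ.+ y ℤ.+ (x ℤ.+ w)
        eq₁ = solve-∀
        eq₂ : ∀ x y z w → x ℤ.+ y ℤ.+ (z ℤ.+ w) ≡ x ℤ.+ w ℤ.+ (z ℤ.+ y)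
        eq₂ = solve-∀
        m+l : m ℤ.+ l ≡ i₂ ℤ.+ j₂ ℤ.+ (i₀ ℤ.+ j₀)
        m+l = cong₂ ℤ._+_ (≡.sym i₂+j₂≡m) (≡.sym i₀+j₀≡l)
        absurd : ⊥
        absurd with i₂ ℤ.≟ i₀ | j₂ ℤ.≟ j₀
        ... | yes ≡.refl | _ = shifts (g-supp hᵢ₁ k₀) (g-supp hᵢ₁ k₂) (≢ˡ i₁≢)
          (≡.trans (cong (ℤ._+ (i₁ ℤ.+ j₀)) (≡.sym i₂+j₂≡m))
            (≡.trans (eq₂ i₀ j₂ i₁ j₀) (cong (ℤ._+ (i₁ ℤ.+ j₂)) i₀+j₀≡l)))
        ... | no _ | yes ≡.refl = shifts (g-supp h₀ kⱼ₁) (g-supp h₂ kⱼ₁) (≢ʳ j₁≢)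
          (≡.trans (cong (ℤ._+ (i₀ ℤ.+ j₁)) (≡.sym i₂+j₂≡m))
            (≡.trans (eq₁ i₂ j₀ i₀ j₁) (cong (ℤ._+ (i₂ ℤ.+ j₁)) i₀+j₀≡l)))
        ... | no i₂≢ | no j₂≢
          with sums (g-supp h₂ k₀) (g-supp h₀ k₂) (≢ˡ i₂≢) (≢ʳ j₂≢) (≡.trans (eq₂ i₂ j₀ i₀ j₂) (≡.sym m+l))
        ...   | eq , at′ = i₂≢ (*-atom-unique h k eq (atom-resp (g≋hk _) at′) h₂ k₀ h₀ k₂)

  module Bounded {K} (bounded : ∀ f → ∣supp∣>1 f → S⟦x⟧.SumOfAtMost K Irreducibles f) where

    atom⇒unit : ∀ {x} → AdditiveAtom x → MultiplicativeUnit x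
    atom⇒unit {x} at with bounded (series (+ 0) (λ _ → x)) (+ 0 , + 1 , (λ ()) , atom≉0 at , atom≉0 at)
    ... | n , n≤K , hs , irr , f≋Σ = from-split (S⟦x⟧.Irreducible.split-∣1 (proj₂ (irr c)) {const} {h′} h≋)
      where
      at-degree : ∀ d → x ≈ sum (λ i → coeff (hs i) (+ d))
      at-degree d = trans (f≋Σ (+ d)) (reflexive (coeff-sum hs (+ d)))
      owner : ∀ d → ∃[ i ] coeff (hs i) (+ d) ≉ 0#
      owner d = sum≉0⇒ _ (≉-resp (at-degree d) (atom≉0 at))
      collision = Fin.pigeonhole {n} {ℕ.suc n} ℕ.≤-refl (λ d → proj₁ (owner (toℕ d)))
      d₁ = proj₁ collision
      d₂ = proj₁ (proj₂ collision)
      c = proj₁ (owner (toℕ d₁))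
      h = hs c
      h-d₁ : coeff h (+ toℕ d₁) ≉ 0#
      h-d₁ = proj₂ (owner (toℕ d₁))
      h-d₂ : coeff h (+ toℕ d₂) ≉ 0#
      h-d₂ = subst (λ i → coeff (hs i) (+ toℕ d₂) ≉ 0#)
        (≡.sym (proj₂ (proj₂ (proj₂ collision)))) (proj₂ (owner (toℕ d₂)))
      d₁≢d₂ : + toℕ d₁ ≢ + toℕ d₂
      d₁≢d₂ eq = ℕ.<⇒≢ (proj₁ (proj₂ (proj₂ collision))) (ℤ.+-injective eq)
      indicator : ∀ y → Dec (y ≈ 0#) → Carrier
      indicator y (yes _) = 0#
      indicator y (no _) = 1#
      h′ : LaurentSeries
      h′ = series (+ 0) (λ d → indicator (coeff h (+ d)) em)
      const : LaurentSeries
      const = series (+ 0) λ { ℕ.zero → x ; (ℕ.suc _) → 0# }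
      const-mono : MonomialAt (+ 0) const
      const-mono (+ 0) ≢0 = contradiction ≡.refl ≢0
      const-mono (+ (ℕ.suc _)) _ = refl
      const-mono -[1+ _ ] _ = refl
      coeff-const-* : ∀ k j → coeff (const *ᴸ k) j ≈ x * coeff k j
      coeff-const-* k j = trans (reflexive (cong (coeff (const *ᴸ k)) (≡.sym (ℤ.+-identityˡ j))))
        (monomial-* const k const-mono j)
      h≋ : h ≋ (const *ᴸ h′)
      h≋ -[1+ d ] = trans (stable λ ≉0 → ⇒sum≉0 (λ i → coeff (hs i) -[1+ d ]) ≉0
          (trans (reflexive (≡.sym (coeff-sum hs _))) (sym (f≋Σ -[1+ d ]))))
        (trans (sym (zeroʳ x)) (sym (coeff-const-* h′ -[1+ d ])))
      h≋ (+ d) = trans (value em) (trans (*-congˡ (reflexive coeff-h′)) (sym (coeff-const-* h′ (+ d))))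
        where
        coeff-h′ : indicator (coeff h (+ d)) em ≡ coeff h′ (+ d)
        coeff-h′ = ≡.sym (cong (Series.extend (+ 0) (λ d → indicator (coeff h (+ d)) em)) (ℤ.+-identityʳ (+ d)))
        value : (dec : Dec (coeff h (+ d) ≈ 0#)) → coeff h (+ d) ≈ x * indicator (coeff h (+ d)) dec
        value (yes h≈0) = trans h≈0 (sym (zeroʳ x))
        value (no h≉0) = trans (sym (sum-atom (λ i → coeff (hs i) (+ d)) {c} (atom-resp (at-degree d) at) h≉0))
          (trans (sym (at-degree d)) (sym (*-identityʳ x)))
      from-split : S⟦x⟧.MultiplicativeUnit const ⊎ S⟦x⟧.MultiplicativeUnit h′ → MultiplicativeUnit x
      from-split (inj₁ (q , q*const≋1)) =
        coeff q (+ 0) , trans (sym (*-monomial q const const-mono (+ 0))) (q*const≋1 (+ 0))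
      from-split (inj₂ h′∣1) = ⊥-elim (d₁≢d₂ (unit-supp {h′} h′∣1 (h′-supp {toℕ d₁} h-d₁) (h′-supp {toℕ d₂} h-d₂)))
        where
        h′-supp : ∀ {d} → coeff h (+ d) ≉ 0# → coeff h′ (+ d) ≉ 0#
        h′-supp {d} h≉0 = *≉0⇒ʳ (≉-resp (trans (h≋ (+ d)) (coeff-const-* h′ (+ d))) h≉0)

  least : ∀ {P : ℕ → Set ℓ} n → P n → ∃[ l ] P l × (∀ {k} → P k → l ℕ.≤ k)
  least {P} n = go (ℕ.<-wellFounded n)
    where
    go : ∀ {n} → Acc _<_ n → P n → ∃[ l ] P l × (∀ {k} → P k → l ℕ.≤ k)
    go {n} (acc rs) Pn with em {∃[ k ] k < n × P k}
    ... | no none = n , Pn , λ Pk → ℕ.≮⇒≥ λ k<n → none (_ , k<n , Pk)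
    ... | yes (k , k<n , Pk) = go (rs k<n) Pk

  Seq : Set a
  Seq = ℕ → Carrier

  infixr 6 _⊕_
  _⊕_ : Seq → Seq → Seq
  (φ ⊕ ψ) k = φ k + ψ k

  ⊕-supp : ∀ φ ψ {k} → (φ ⊕ ψ) k ≉ 0# → φ k ≉ 0# ⊎ ψ k ≉ 0#
  ⊕-supp φ ψ {k} ≉0 with em {φ k ≈ 0#}
  ... | no φₖ≉0 = inj₁ φₖ≉0
  ... | yes φₖ≈0 = inj₂ λ ψₖ≈0 → ≉0 (trans (+-cong φₖ≈0 ψₖ≈0) (+-identityˡ 0#))

  +≉0ˡ : ∀ {x y} → x ≉ 0# → x + y ≉ 0#
  +≉0ˡ x≉0 = x≉0 ∘ +≈0⇒ˡ

  +≉0ʳ : ∀ {x y} → y ≉ 0# → x + y ≉ 0#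
  +≉0ʳ y≉0 = y≉0 ∘ +≈0⇒ʳ

  atom-+ˡ : ∀ {x y} → AdditiveAtom x → ¬ y ≉ 0# → AdditiveAtom (x + y)
  atom-+ˡ at ¬y≉0 = atom-resp (sym (trans (+-congˡ (stable ¬y≉0)) (+-identityʳ _))) at

  atom-+ʳ : ∀ {x y} → ¬ x ≉ 0# → AdditiveAtom y → AdditiveAtom (x + y)
  atom-+ʳ ¬x≉0 at = atom-resp (sym (trans (+-congʳ (stable ¬x≉0)) (+-identityˡ _))) at

  abstract
    mono : Carrier → ℕ → Seq
    mono u n k with k ℕ.≟ n
    ... | yes _ = u
    ... | no _ = 0#

    mono-at : ∀ u n → mono u n n ≈ u
    mono-at u n with n ℕ.≟ n
    ... | yes _ = refl
    ... | no n≢n = contradiction ≡.refl n≢n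

    mono-supp : ∀ u n {k} → mono u n k ≉ 0# → k ≡ n
    mono-supp u n {k} ≉0 with k ℕ.≟ n
    ... | yes eq = eq
    ... | no _ = contradiction refl ≉0

    infixl 7 _↾_
    _↾_ : ∀ {p} {P : ℕ → Set p} → Seq → (∀ k → Dec (P k)) → Seq
    (φ ↾ P?) k with P? k
    ... | yes _ = φ k
    ... | no _ = 0#

    ↾-supp : ∀ {p} {P : ℕ → Set p} φ (P? : ∀ k → Dec (P k)) {k} → (φ ↾ P?) k ≉ 0# → P k × φ k ≉ 0#
    ↾-supp φ P? {k} ≉0 with P? k
    ... | yes Pk = Pk , ≉0
    ... | no _ = contradiction refl ≉0

    ↾-split : ∀ {p} {P : ℕ → Set p} φ (P? : ∀ k → Dec (P k)) k → φ k ≈ (φ ↾ P?) k + (φ ↾ (¬? ∘ P?)) k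
    ↾-split φ P? k with P? k
    ... | yes _ = sym (+-identityʳ _)
    ... | no _ = sym (+-identityˡ _)

  other? : ∀ (φ : Seq) l → (∃[ m ] m ≢ l × φ m ≉ 0#) ⊎ (∀ {m} → φ m ≉ 0# → m ≡ l)
  other? φ l with em {∃[ m ] m ≢ l × φ m ≉ 0#}
  ... | yes other = inj₁ other
  ... | no none = inj₂ λ {m} φₘ≉0 → decidable-stable (m ℕ.≟ l) λ m≢l → none (m , m≢l , φₘ≉0)

  Infinite Finite : Seq → Set ℓ
  Infinite φ = ∀ N → ∃[ M ] N < M × φ M ≉ 0#
  Finite φ = ∃[ B ] (∀ {k} → φ k ≉ 0# → k ℕ.≤ B)

  ⊕-finite : ∀ φ ψ → Finite φ → Finite ψ → Finite (φ ⊕ ψ)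
  ⊕-finite φ ψ (B , φ≤B) (C , ψ≤C) = B ℕ.+ C , [ (λ φₖ → ℕ.≤-trans (φ≤B φₖ) (ℕ.m≤m+n B C))
    , (λ ψₖ → ℕ.≤-trans (ψ≤C ψₖ) (ℕ.m≤n+m C B)) ]′ ∘ ⊕-supp φ ψ

  finite? : ∀ φ → Finite φ ⊎ Infinite φ
  finite? φ with em {Finite φ}
  ... | yes fin = inj₁ fin
  ... | no ¬fin = inj₂ beyond
    where
    beyond : Infinite φ
    beyond N with em {∃[ M ] N < M × φ M ≉ 0#}
    ... | yes found = found
    ... | no none = contradiction (N , λ φₖ≉0 → ℕ.≮⇒≥ λ N<k → none (_ , N<k , φₖ≉0)) ¬fin

  greatest : ∀ φ {i} → φ i ≉ 0# → Finite φ → ∃[ M ] φ M ≉ 0# × (∀ {k} → φ k ≉ 0# → k ℕ.≤ M)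
  greatest φ {i} φᵢ≉0 (B , ≤B) = go B ≤B
    where
    go : ∀ B → (∀ {k} → φ k ≉ 0# → k ℕ.≤ B) → ∃[ M ] φ M ≉ 0# × (∀ {k} → φ k ≉ 0# → k ℕ.≤ M)
    go B ≤B with em {φ B ≈ 0#}
    go B ≤B | no φ≉0 = B , φ≉0 , ≤B
    go ℕ.zero ≤B | yes φ≈0 with ℕ.z≤n ← ≤B φᵢ≉0 = contradiction φ≈0 φᵢ≉0
    go (ℕ.suc B) ≤B | yes φ≈0 = go B λ φₖ≉0 → ℕ.≤-pred (ℕ.≤∧≢⇒< (≤B φₖ≉0) λ { ≡.refl → φₖ≉0 φ≈0 })

  record IrreducibleSeq (φ : Seq) : Set (a ⊔ ℓ) where
    constructor irreducibleSeq
    field irreducible : ∀ b → S⟦x⟧.MultiplicativeIrreducible (series b φ)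

  record SumOfThree (φ : Seq) : Set (a ⊔ ℓ) where
    constructor sumOfThreeSeq
    field sumOfThree : ∀ b → S⟦x⟧.SumOfAtMost 3 Irreducibles (series b φ)

  sumOfThree : ∀ {φ n} (gs : Vector Seq n) → n ℕ.≤ 3 → (∀ i → IrreducibleSeq (gs i)) →
    (∀ d → φ d ≈ sum (λ i → gs i d)) → SumOfThree φ
  sumOfThree {φ} {n} gs n≤3 irr φ≈Σ = sumOfThreeSeq λ a → n , n≤3 , (λ i → series a (gs i)) ,
    (λ i → IrreducibleSeq.irreducible (irr i) a) ,
    λ d → trans (go a (d ℤ.- a)) (reflexive (≡.sym (coeff-sum (λ i → series a (gs i)) d)))
    where
    go : ∀ a x → Series.extend a φ x ≈ sum (λ i → Series.extend a (gs i) x)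
    go a (+ d) = φ≈Σ d
    go a -[1+ _ ] = sym (sum-replicate-zero n)

  sum₁ : ∀ {φ p} → IrreducibleSeq p → (∀ d → φ d ≈ p d) → SumOfThree φ
  sum₁ {φ} {p} P eq = sumOfThree (p ∷ []) (s≤s ℕ.z≤n) (λ { Fin.zero → P }) λ d → trans (eq d) (sym (+-identityʳ _))

  sum₂ : ∀ {φ p q} → IrreducibleSeq p → IrreducibleSeq q → (∀ d → φ d ≈ p d + q d) → SumOfThree φ
  sum₂ {φ} {p} {q} P Q eq = sumOfThree (p ∷ q ∷ []) (s≤s (s≤s ℕ.z≤n)) (λ { Fin.zero → P ; (Fin.suc Fin.zero) → Q })
    λ d → trans (eq d) (+-congˡ (sym (+-identityʳ _)))

  sum₃ : ∀ {φ p q r} → IrreducibleSeq p → IrreducibleSeq q → IrreducibleSeq r →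
    (∀ d → φ d ≈ p d + (q d + r d)) → SumOfThree φ
  sum₃ {φ} {p} {q} {r} P Q R eq = sumOfThree (p ∷ q ∷ r ∷ []) ℕ.≤-refl
    (λ { Fin.zero → P ; (Fin.suc Fin.zero) → Q ; (Fin.suc (Fin.suc Fin.zero)) → R })
    λ d → trans (eq d) (+-congˡ (+-congˡ (sym (+-identityʳ _))))

  record SumFree (l : ℕ) (φ : Seq) : Set (a ⊔ ℓ) where
    field
      lead-atom : AdditiveAtom (φ l)
      lead      : ∀ {s} → φ s ≉ 0# → l ℕ.≤ s
      sum-free  : ∀ {s t v} → φ s ≉ 0# → φ t ≉ 0# → φ v ≉ 0# → s ≢ l → t ≢ l → v ≢ l → s ℕ.+ t ≢ v ℕ.+ l

  double-≤ : ∀ {s t M l} → s ℕ.+ s ℕ.≤ M → t ℕ.+ t ℕ.≤ M → s ℕ.+ t ≡ M ℕ.+ l → s ≡ t × s ℕ.+ s ≡ M × l ≡ 0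
  double-≤ {s} {t} {M} {l} 2s≤M 2t≤M eq = s≡t , 2s≡M , l≡0
    where
    M≤s+t = subst (M ℕ.≤_) (≡.sym eq) (ℕ.m≤m+n M l)
    s≡t = ℕ.≤-antisym (ℕ.+-cancelˡ-≤ s s t (ℕ.≤-trans 2s≤M M≤s+t)) (ℕ.+-cancelʳ-≤ t t s (ℕ.≤-trans 2t≤M M≤s+t))
    2s≡M+l = ≡.trans (cong (s ℕ.+_) s≡t) eq
    l≡0 = ℕ.n≤0⇒n≡0 (ℕ.+-cancelˡ-≤ M l 0 (subst₂ ℕ._≤_ 2s≡M+l (≡.sym (ℕ.+-identityʳ M)) 2s≤M))
    2s≡M = ≡.trans 2s≡M+l (≡.trans (cong (M ℕ.+_) l≡0) (ℕ.+-identityʳ M))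

  even-or-odd : ∀ d c → d ℕ.+ d ∣ c ℕ.* d ⊎ ∃[ e ] c ℕ.* d ≡ d ℕ.+ e ℕ.* (d ℕ.+ d)
  even-or-odd d ℕ.zero = inj₁ (divides 0 ≡.refl)
  even-or-odd d (ℕ.suc c) with even-or-odd d c
  ... | inj₁ (divides e eq) = inj₂ (e , cong (d ℕ.+_) eq)
  ... | inj₂ (e , eq) = inj₁ (divides (ℕ.suc e) (≡.trans (cong (d ℕ.+_) eq) (≡.sym (ℕ.+-assoc d d _))))

  odd+odd : ∀ {d s t} → d ∣ s → d ∣ t → ¬ d ℕ.+ d ∣ s → ¬ d ℕ.+ d ∣ t → d ℕ.+ d ∣ s ℕ.+ t
  odd+odd {d} (divides c ≡.refl) (divides c′ ≡.refl) ∤s ∤t with even-or-odd d c | even-or-odd d c′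
  ... | inj₁ ∣s | _ = contradiction ∣s ∤s
  ... | inj₂ _ | inj₁ ∣t = contradiction ∣t ∤t
  ... | inj₂ (e , eq) | inj₂ (e′ , eq′) = subst₂ (λ x y → d ℕ.+ d ∣ x ℕ.+ y) (≡.sym eq) (≡.sym eq′)
    (divides (ℕ.suc (e ℕ.+ e′)) (expand d e e′))
    where
    expand : ∀ d e e′ → d ℕ.+ e ℕ.* (d ℕ.+ d) ℕ.+ (d ℕ.+ e′ ℕ.* (d ℕ.+ d)) ≡ ℕ.suc (e ℕ.+ e′) ℕ.* (d ℕ.+ d)
    expand = ℕ.solve-∀

  -- Doubling a common divisor of the support stops after at most s steps.
  parity-scale : ∀ (φ : Seq) {s} → φ s ≉ 0# → s ≢ 0 →
    ∃[ d ] (∀ {k} → φ k ≉ 0# → d ∣ k) × ∃[ b ] φ b ≉ 0# × ¬ d ℕ.+ d ∣ b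
  parity-scale φ {s} φₛ s≢0 = go s 1 (ℕ.m≤n+m s 1) (s≤s ℕ.z≤n) λ {k} _ → divides k (≡.sym (ℕ.*-identityʳ k))
    where
    go : ∀ fuel d → s ℕ.≤ d ℕ.+ fuel → 0 < d → (∀ {k} → φ k ≉ 0# → d ∣ k) →
      ∃[ d ] (∀ {k} → φ k ≉ 0# → d ∣ k) × ∃[ b ] φ b ≉ 0# × ¬ d ℕ.+ d ∣ b
    go fuel d s≤ 0<d common with em {∃[ b ] φ b ≉ 0# × ¬ d ℕ.+ d ∣ b}
    ... | yes (b , φb , ∤b) = d , common , b , φb , ∤b
    go ℕ.zero d s≤ 0<d common | no none = contradiction
      (ℕ.≤-trans (ℕ.∣⇒≤ {{ℕ.≢-nonZero s≢0}} (decidable-stable (d ℕ.+ d ∣? s) λ ∤s → none (s , φₛ , ∤s)))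
        (ℕ.≤-trans s≤ (ℕ.≤-reflexive (ℕ.+-identityʳ d))))
      (ℕ.<⇒≱ (ℕ.m<m+n d 0<d))
    go (ℕ.suc fuel) d s≤ 0<d common | no none = go fuel (d ℕ.+ d)
      (ℕ.≤-trans s≤ (ℕ.≤-trans (ℕ.+-monoʳ-≤ d (ℕ.+-monoˡ-≤ fuel 0<d)) (ℕ.≤-reflexive (≡.sym (ℕ.+-assoc d d fuel)))))
      (ℕ.<-≤-trans 0<d (ℕ.m≤m+n d d)) λ {k} φₖ → decidable-stable (d ℕ.+ d ∣? k) λ ∤k → none (k , φₖ , ∤k)

  module Decompose
    (atom⇒unit : ∀ {x} → AdditiveAtom x → MultiplicativeUnit x)
    (split-atom : ∀ {x} → x ≉ 0# → ∃[ u ] ∃[ y ] AdditiveAtom u × x ≈ u + y)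
    where

    isolated⇒irreducibleSeq : ∀ {φ l m n} → φ l ≉ 0# → φ m ≉ 0# → m ≢ l →
      (∀ {s t} → φ s ≉ 0# → φ t ≉ 0# → s ≢ l → t ≢ l → s ℕ.+ t ≡ m ℕ.+ l → s ≡ t × AdditiveAtom (φ s)) →
      (∀ {s t} → φ s ≉ 0# → φ t ≉ 0# → s ≢ l → m ℕ.+ s ≢ l ℕ.+ t) →
      AdditiveAtom (φ n) → IrreducibleSeq φ
    isolated⇒irreducibleSeq {φ} {l} {m} {n} φₗ φₘ m≢l sums shifts at = irreducibleSeq λ a →
      let open At a in Criterion.isolated⇒irreducible atom⇒unit {series a φ} {at′ l} {at′ m} {at′ n}
        (≉-resp-≡ (≡.sym (coeff-series a φ l)) φₗ) (≉-resp-≡ (≡.sym (coeff-series a φ m)) φₘ) (m≢l ∘ at-injective)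
        (λ {s} {t} → sums′ {s} {t}) (λ {s} {t} → shifts′ {s} {t}) (subst AdditiveAtom (≡.sym (coeff-series a φ n)) at)
      where
      module At (a : ℤ) where
        at′ : ℕ → ℤ
        at′ k = a ℤ.+ + k
        at-injective : ∀ {j k} → at′ j ≡ at′ k → j ≡ k
        at-injective {j} {k} eq = ℤ.+-injective (ℤ+.∙-cancelˡ a (+ j) (+ k) eq)
        at-sum : ∀ {i j k l} → at′ i ℤ.+ at′ j ≡ at′ k ℤ.+ at′ l → i ℕ.+ j ≡ k ℕ.+ l
        at-sum {i} {j} {k} {l} eq = ℤ.+-injective (ℤ+.∙-cancelˡ (a ℤ.+ a) (+ (i ℕ.+ j)) (+ (k ℕ.+ l))
          (≡.trans (≡.sym (degree-sum a a (+ i) (+ j))) (≡.trans eq (degree-sum a a (+ k) (+ l)))))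
        sums′ : ∀ {s t} → coeff (series a φ) s ≉ 0# → coeff (series a φ) t ≉ 0# → s ≢ at′ l → t ≢ at′ l →
          s ℤ.+ t ≡ at′ m ℤ.+ at′ l → s ≡ t × AdditiveAtom (coeff (series a φ) s)
        sums′ {s} {t} fₛ fₜ s≢ t≢ eq with supp-series a φ {s} fₛ | supp-series a φ {t} fₜ
        ... | s′ , ≡.refl , φₛ | t′ , ≡.refl , φₜ
          with sums φₛ φₜ (s≢ ∘ cong at′) (t≢ ∘ cong at′) (at-sum {s′} {t′} {m} {l} eq)
        ...   | s≡t , at″ = cong at′ s≡t , subst AdditiveAtom (≡.sym (coeff-series a φ s′)) at″
        shifts′ : ∀ {s t} → coeff (series a φ) s ≉ 0# → coeff (series a φ) t ≉ 0# → s ≢ at′ l →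
          at′ m ℤ.+ s ≢ at′ l ℤ.+ t
        shifts′ {s} {t} fₛ fₜ s≢ eq with supp-series a φ {s} fₛ | supp-series a φ {t} fₜ
        ... | s′ , ≡.refl , φₛ | t′ , ≡.refl , φₜ = shifts φₛ φₜ (s≢ ∘ cong at′) (at-sum {m} {s′} {l} {t′} eq)

    sumFree⇒irreducible : ∀ {φ l m} → SumFree l φ → m ≢ l → φ m ≉ 0# → IrreducibleSeq φ
    sumFree⇒irreducible {φ} {l} {m} sf m≢l φₘ = isolated⇒irreducibleSeq {φ} {l} {m} {l} (atom≉0 lead-atom) φₘ m≢l
      (λ φₛ φₜ s≢ t≢ eq → ⊥-elim (sum-free φₛ φₜ φₘ s≢ t≢ m≢l eq)) shifts lead-atom
      where
      open SumFree sf
      shifts : ∀ {s t} → φ s ≉ 0# → φ t ≉ 0# → s ≢ l → m ℕ.+ s ≢ l ℕ.+ t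
      shifts {s} {t} φₛ φₜ s≢ eq with t ℕ.≟ l
      ... | yes ≡.refl = ℕ.<⇒≢ (ℕ.+-mono-<-≤ (ℕ.≤∧≢⇒< (lead φₘ) (m≢l ∘ ≡.sym)) (lead φₛ)) (≡.sym eq)
      ... | no t≢ = sum-free φₘ φₛ φₜ m≢l s≢ t≢ (≡.trans eq (ℕ.+-comm l t))

    -- The exponent M can only be the sum of M/2 with itself, which an atom at M/2 excludes.
    distant⇒irreducible : ∀ {φ i M} → AdditiveAtom (φ M) → φ i ≉ 0# → i ≢ M →
      (∀ {s} → φ s ≉ 0# → s ≢ M → s ℕ.+ s ℕ.≤ M) →
      (∀ {s} → φ 0 ≉ 0# → φ s ≉ 0# → s ≢ M → s ℕ.+ s ≡ M → AdditiveAtom (φ s)) → IrreducibleSeq φ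
    distant⇒irreducible {φ} {i} {M} at φᵢ i≢M small half
      with l , φₗ , lead ← least {λ k → φ k ≉ 0#} i φᵢ =
      isolated⇒irreducibleSeq {φ} {l} {M} {M} φₗ (atom≉0 at) M≢l sums shifts at
      where
      ≤M : ∀ {s} → φ s ≉ 0# → s ≢ M → s ℕ.≤ M
      ≤M φₛ s≢M = ℕ.≤-trans (ℕ.m≤m+n _ _) (small φₛ s≢M)
      M≢l : M ≢ l
      M≢l ≡.refl = i≢M (ℕ.≤-antisym (≤M φᵢ i≢M) (lead φᵢ))
      sums : ∀ {s t} → φ s ≉ 0# → φ t ≉ 0# → s ≢ l → t ≢ l → s ℕ.+ t ≡ M ℕ.+ l → s ≡ t × AdditiveAtom (φ s)
      sums {s} {t} φₛ φₜ s≢l t≢l eq = s≡t , half (subst (λ k → φ k ≉ 0#) l≡0 φₗ) φₛ s≢M 2s≡M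
        where
        s≢M : s ≢ M
        s≢M ≡.refl = t≢l (ℕ.+-cancelˡ-≡ s t l eq)
        t≢M : t ≢ M
        t≢M ≡.refl = s≢l (ℕ.+-cancelʳ-≡ t s l (≡.trans eq (ℕ.+-comm t l)))
        arith = double-≤ {s} {t} {M} {l} (small φₛ s≢M) (small φₜ t≢M) eq
        s≡t = proj₁ arith
        2s≡M = proj₁ (proj₂ arith)
        l≡0 = proj₂ (proj₂ arith)
      shifts : ∀ {s t} → φ s ≉ 0# → φ t ≉ 0# → s ≢ l → M ℕ.+ s ≢ l ℕ.+ t
      shifts {s} {t} φₛ φₜ s≢l eq = ℕ.<⇒≢ (ℕ.+-mono-<-≤ (ℕ.≤∧≢⇒< (lead φₛ) (s≢l ∘ ≡.sym)) (≤M φₜ t≢M))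
        (≡.trans (≡.sym eq) (ℕ.+-comm M s))
        where
        t≢M : t ≢ M
        t≢M ≡.refl = s≢l (ℕ.+-cancelˡ-≡ t s l (≡.trans eq (ℕ.+-comm l t)))

    record Extraction (φ : Seq) (n : ℕ) : Set (a ⊔ ℓ) where
      field
        {unit}    : Carrier
        rest      : Seq
        unit-atom : AdditiveAtom unit
        split     : ∀ k → φ k ≈ mono unit n k + rest k
        rest≈     : ∀ {k} → k ≢ n → rest k ≈ φ k
      rest-supp : ∀ {k} → rest k ≉ 0# → φ k ≉ 0#
      rest-supp ≉0 = ≉-resp (sym (split _)) (+≉0ʳ ≉0)
      keep : ∀ {k} → k ≢ n → φ k ≉ 0# → rest k ≉ 0#
      keep k≢n = ≉-resp (sym (rest≈ k≢n))

    abstract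
      extract : ∀ φ n → φ n ≉ 0# → Extraction φ n
      extract φ n φₙ with u , y , at , eq ← split-atom φₙ = record
        { rest = rest ; unit-atom = at ; split = split ; rest≈ = rest≈ }
        where
        rest : Seq
        rest k with k ℕ.≟ n
        ... | yes _ = y
        ... | no _ = φ k
        split : ∀ k → φ k ≈ mono u n k + rest k
        split k with k ℕ.≟ n
        ... | yes ≡.refl = eq
        ... | no _ = sym (+-identityˡ _)
        rest≈ : ∀ {k} → k ≢ n → rest k ≈ φ k
        rest≈ {k} k≢n with k ℕ.≟ n
        ... | yes eq = contradiction eq k≢n
        ... | no _ = refl

    absorb : ∀ {g r l i} → SumFree l g → Infinite g → Finite r → r i ≉ 0# →
      ∃[ g′ ] ∃[ r′ ] IrreducibleSeq g′ × IrreducibleSeq r′ × (∀ k → g k + r k ≈ g′ k + r′ k)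
    absorb {g} {r} {l} {i} sf inf (B , r≤B) rᵢ with M , N<M , gM ← inf (B ℕ.+ B ℕ.+ l) =
      rest , mono unit M ⊕ r , sumFree⇒irreducible sf′ m≢l rest-m ,
      distant⇒irreducible {i = i} {M} at (+≉0ʳ rᵢ) i≢M small half ,
      λ k → trans (+-congʳ (trans (split k) (+-comm _ _))) (+-assoc _ _ _)
      where
      open Extraction (extract g M gM)
      open SumFree sf
      2B<M : B ℕ.+ B < M
      2B<M = ℕ.≤-<-trans (ℕ.m≤m+n (B ℕ.+ B) l) N<M
      l<M : l < M
      l<M = ℕ.≤-<-trans (ℕ.m≤n+m l (B ℕ.+ B)) N<M
      B<M : B < M
      B<M = ℕ.≤-<-trans (ℕ.m≤m+n B B) 2B<M
      sf′ : SumFree l rest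
      sf′ = record
        { lead-atom = atom-resp (sym (rest≈ (ℕ.<⇒≢ l<M))) lead-atom
        ; lead = lead ∘ rest-supp
        ; sum-free = λ s t v → sum-free (rest-supp s) (rest-supp t) (rest-supp v)
        }
      beyond = inf M
      m = proj₁ beyond
      M<m : M < m
      M<m = proj₁ (proj₂ beyond)
      rest-m : rest m ≉ 0#
      rest-m = keep (≡.≢-sym (ℕ.<⇒≢ M<m)) (proj₂ (proj₂ beyond))
      m≢l : m ≢ l
      m≢l = ≡.≢-sym (ℕ.<⇒≢ (ℕ.<-trans l<M M<m))
      at : AdditiveAtom (mono unit M M + r M)
      at = atom-+ˡ (atom-resp (sym (mono-at unit M)) unit-atom) λ rM → ℕ.<⇒≱ B<M (r≤B rM)
      i≢M : i ≢ M
      i≢M = ℕ.<⇒≢ (ℕ.≤-<-trans (r≤B rᵢ) B<M)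
      double< : ∀ {s} → (mono unit M ⊕ r) s ≉ 0# → s ≢ M → s ℕ.+ s < M
      double< ≉0 s≢M with ⊕-supp (mono unit M) r ≉0
      ... | inj₁ mono≉0 = contradiction (mono-supp unit M mono≉0) s≢M
      ... | inj₂ rₛ = ℕ.≤-<-trans (ℕ.+-mono-≤ (r≤B rₛ) (r≤B rₛ)) 2B<M
      small : ∀ {s} → (mono unit M ⊕ r) s ≉ 0# → s ≢ M → s ℕ.+ s ℕ.≤ M
      small ≉0 s≢M = ℕ.<⇒≤ (double< ≉0 s≢M)
      half : ∀ {s} → (mono unit M ⊕ r) 0 ≉ 0# → (mono unit M ⊕ r) s ≉ 0# → s ≢ M → s ℕ.+ s ≡ M →
        AdditiveAtom ((mono unit M ⊕ r) s)
      half _ ≉0 s≢M 2s≡M = contradiction 2s≡M (ℕ.<⇒≢ (double< ≉0 s≢M))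

    infinite-assembly : ∀ {φ g h r l l′} → SumFree l g → Infinite g → SumFree l′ h → Finite r →
      (∀ k → φ k ≈ g k + (h k + r k)) → SumOfThree φ
    infinite-assembly {φ} {g} {h} {r} {l} {l′} sfg inf sfh r-fin eq with other? h l′
    ... | inj₂ h-mono =
      let g′ , r′ , G , R , eq′ = absorb {r = h ⊕ r} {i = l′} sfg inf
            (⊕-finite h r (l′ , ℕ.≤-reflexive ∘ h-mono) r-fin) (+≉0ˡ (atom≉0 (SumFree.lead-atom sfh)))
      in sum₂ G R λ k → trans (eq k) (eq′ k)
    ... | inj₁ (m , m≢l′ , hₘ) with em {∃[ i ] r i ≉ 0#}
    ...   | yes (i , rᵢ) =
      let g′ , r′ , G , R , eq′ = absorb sfg inf r-fin rᵢ
      in sum₃ {p = g′} {h} {r′} G (sumFree⇒irreducible sfh m≢l′ hₘ) R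
        λ k → trans (eq k) (trans (x∙yz≈y∙xz (g k) (h k) (r k))
          (trans (+-congˡ (eq′ k)) (x∙yz≈y∙xz (h k) (g′ k) (r′ k))))
    ...   | no r≈0 with k , l<k , gₖ ← inf l =
      sum₂ (sumFree⇒irreducible sfg (≡.≢-sym (ℕ.<⇒≢ l<k)) gₖ) (sumFree⇒irreducible sfh m≢l′ hₘ)
        λ k → trans (eq k) (+-congˡ (trans (+-congˡ (stable λ rₖ → r≈0 (k , rₖ))) (+-identityʳ _)))

    infinite⇒sumOfThree : ∀ {φ} → φ 0 ≉ 0# → Infinite φ → SumOfThree φ
    infinite⇒sumOfThree {φ} φ₀ inf with _ , 0<s , φₛ ← inf 0
      with d , common , b , φb , ∤b ← parity-scale φ φₛ (≡.≢-sym (ℕ.<⇒≢ 0<s)) = result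
      where
      module E₁ = Extraction (extract φ 0 φ₀)
      b≢0 : b ≢ 0
      b≢0 ≡.refl = ∤b (divides 0 ≡.refl)
      module E₂ = Extraction (extract E₁.rest b (E₁.keep b≢0 φb))
      φ₂ = E₂.rest
      φ₂-supp : ∀ {k} → φ₂ k ≉ 0# → φ k ≉ 0#
      φ₂-supp {k} = E₁.rest-supp {k} ∘ E₂.rest-supp {k}
      odd? : ∀ k → Dec (¬ d ℕ.+ d ∣ k)
      odd? k = ¬? (d ℕ.+ d ∣? k)
      even = φ₂ ↾ (¬? ∘ odd?)
      p = mono E₁.unit 0 ⊕ (φ₂ ↾ odd?)
      q = mono E₂.unit b ⊕ (even ↾ (b ℕ.<?_))
      r = even ↾ (¬? ∘ (b ℕ.<?_))
      φ≈ : ∀ k → φ k ≈ p k + (q k + r k)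
      φ≈ k = trans (E₁.split k) (trans (+-congˡ (trans (E₂.split k)
          (+-congˡ (trans (↾-split φ₂ odd? k) (+-congˡ (↾-split even (b ℕ.<?_) k))))))
        (regroup (mono E₁.unit 0 k) (mono E₂.unit b k) ((φ₂ ↾ odd?) k) ((even ↾ (b ℕ.<?_)) k) (r k)))
        where
        regroup : ∀ u v x y z → u + (v + (x + (y + z))) ≈ (u + x) + ((v + y) + z)
        regroup = MS.solve 5 (λ u v x y z → u MS.⊕ (v MS.⊕ (x MS.⊕ (y MS.⊕ z)))
          MS.⊜ (u MS.⊕ x) MS.⊕ ((v MS.⊕ y) MS.⊕ z)) refl
      p-supp : ∀ {s} → p s ≉ 0# → s ≢ 0 → (¬ d ℕ.+ d ∣ s) × d ∣ s
      p-supp {s} pₛ s≢0 with ⊕-supp (mono E₁.unit 0) (φ₂ ↾ odd?) {s} pₛ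
      ... | inj₁ mono≉0 = contradiction (mono-supp E₁.unit 0 mono≉0) s≢0
      ... | inj₂ odd≉0 = proj₁ (↾-supp φ₂ odd? odd≉0) , common (φ₂-supp (proj₂ (↾-supp φ₂ odd? odd≉0)))
      even-supp : ∀ {s} → even s ≉ 0# → d ℕ.+ d ∣ s
      even-supp {s} evenₛ = decidable-stable (d ℕ.+ d ∣? s) (proj₁ (↾-supp φ₂ (¬? ∘ odd?) evenₛ))
      q-supp : ∀ {s} → q s ≉ 0# → s ≢ b → b < s × d ℕ.+ d ∣ s
      q-supp {s} qₛ s≢b with ⊕-supp (mono E₂.unit b) (even ↾ (b ℕ.<?_)) {s} qₛ
      ... | inj₁ mono≉0 = contradiction (mono-supp E₂.unit b mono≉0) s≢b
      ... | inj₂ even≉0 = proj₁ (↾-supp even (b ℕ.<?_) even≉0) , even-supp (proj₂ (↾-supp even (b ℕ.<?_) even≉0))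
      r≤b : ∀ {s} → r s ≉ 0# → s ℕ.≤ b
      r≤b rₛ = ℕ.≮⇒≥ (proj₁ (↾-supp even (¬? ∘ (b ℕ.<?_)) rₛ))
      sfp : SumFree 0 p
      sfp = record
        { lead-atom = atom-+ˡ (atom-resp (sym (mono-at E₁.unit 0)) E₁.unit-atom)
            λ odd₀ → proj₁ (↾-supp φ₂ odd? odd₀) (divides 0 ≡.refl)
        ; lead = λ _ → ℕ.z≤n
        ; sum-free = λ pₛ pₜ pᵥ s≢ t≢ v≢ eq → proj₁ (p-supp pᵥ v≢) (subst (d ℕ.+ d ∣_) (≡.trans eq (ℕ.+-identityʳ _))
            (odd+odd (proj₂ (p-supp pₛ s≢)) (proj₂ (p-supp pₜ t≢)) (proj₁ (p-supp pₛ s≢)) (proj₁ (p-supp pₜ t≢))))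
        }
      q-lead : ∀ {s} → q s ≉ 0# → b ℕ.≤ s
      q-lead {s} qₛ = [ ℕ.≤-reflexive ∘ ≡.sym , (λ s≢b → ℕ.<⇒≤ (proj₁ (q-supp qₛ s≢b))) ]′ (toSum (s ℕ.≟ b))
      sfq : SumFree b q
      sfq = record
        { lead-atom = atom-+ˡ (atom-resp (sym (mono-at E₂.unit b)) E₂.unit-atom)
            λ evenb → ℕ.n≮n b (proj₁ (↾-supp even (b ℕ.<?_) evenb))
        ; lead = q-lead
        ; sum-free = λ {s} {t} {v} qₛ qₜ qᵥ s≢ t≢ v≢ eq → ∤b (ℕ.∣m+n∣m⇒∣n
            (subst (d ℕ.+ d ∣_) eq (ℕ.∣m∣n⇒∣m+n (proj₂ (q-supp qₛ s≢)) (proj₂ (q-supp qₜ t≢)))) (proj₂ (q-supp qᵥ v≢)))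
        }
      result : SumOfThree φ
      result with finite? p
      ... | inj₂ p-inf = infinite-assembly sfp p-inf sfq (b , r≤b) φ≈
      ... | inj₁ p-fin with finite? q
      ...   | inj₂ q-inf = infinite-assembly sfq q-inf sfp (b , r≤b) λ k → trans (φ≈ k) (x∙yz≈y∙xz (p k) (q k) (r k))
      ...   | inj₁ q-fin with B , ≤B ← ⊕-finite p (q ⊕ r) p-fin (⊕-finite q r q-fin (b , r≤b))
        with M , B<M , φM ← inf B =
        contradiction (≤B (≉-resp (φ≈ M) φM)) (ℕ.<⇒≱ B<M)

    upper⇒irreducible : ∀ {φ m M} → AdditiveAtom (φ 0) → (∀ {s} → φ s ≉ 0# → s ≢ 0 → M < s ℕ.+ s) →
      (∀ {s} → φ s ≉ 0# → s ℕ.≤ M) → φ m ≉ 0# → m ≢ 0 → IrreducibleSeq φ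
    upper⇒irreducible {φ} {m} {M} at upper ≤M φₘ m≢0 = sumFree⇒irreducible sf m≢0 φₘ
      where
      sf : SumFree 0 φ
      sf = record
        { lead-atom = at
        ; lead = λ _ → ℕ.z≤n
        ; sum-free = λ {s} {t} {v} φₛ φₜ φᵥ s≢0 t≢0 _ eq → s≢0 (absurd {s} {t} (upper φₛ s≢0) (upper φₜ t≢0)
            (ℕ.≤-trans (ℕ.≤-reflexive (≡.trans eq (ℕ.+-identityʳ v))) (≤M φᵥ)))
        }
        where
        absurd : ∀ {s t} → M < s ℕ.+ s → M < t ℕ.+ t → s ℕ.+ t ℕ.≤ M → s ≡ 0
        absurd {s} {t} M<2s M<2t s+t≤M = contradiction
          (ℕ.+-cancelˡ-< s t s (ℕ.≤-<-trans s+t≤M M<2s))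
          (ℕ.<⇒≯ (ℕ.+-cancelʳ-< t s t (ℕ.≤-<-trans s+t≤M M<2t)))

    module _ {φ M} (M≢0 : M ≢ 0) (≤M : ∀ {k} → φ k ≉ 0# → k ℕ.≤ M)
      (E₁ : Extraction φ 0) (E₂ : Extraction (Extraction.rest E₁) M) where

      private
        module E₁ = Extraction E₁
        module E₂ = Extraction E₂

      2M≰M : ¬ M ℕ.+ M ℕ.≤ M
      2M≰M 2M≤M = M≢0 (ℕ.n≤0⇒n≡0 (ℕ.+-cancelˡ-≤ M M 0 (ℕ.≤-trans 2M≤M (ℕ.≤-reflexive (≡.sym (ℕ.+-identityʳ M))))))

      no-middle⇒sumOfThree : (∀ {h} → h ℕ.+ h ≡ M → ¬ φ h ≉ 0#) → SumOfThree φ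
      no-middle⇒sumOfThree no-middle = result
        where
        high? : ∀ k → Dec (M < k ℕ.+ k)
        high? k = M ℕ.<? k ℕ.+ k
        hi = E₂.rest ↾ high?
        lo = E₂.rest ↾ (¬? ∘ high?)
        p = mono E₁.unit 0 ⊕ hi
        q = mono E₂.unit M ⊕ lo
        φ≈ : ∀ k → φ k ≈ p k + q k
        φ≈ k = trans (E₁.split k) (trans (+-congˡ (trans (E₂.split k) (+-congˡ (↾-split E₂.rest high? k))))
          (regroup (mono E₁.unit 0 k) (mono E₂.unit M k) (hi k) (lo k)))
          where
          regroup : ∀ u v x y → u + (v + (x + y)) ≈ (u + x) + (v + y)
          regroup = MS.solve 4 (λ u v x y → u MS.⊕ (v MS.⊕ (x MS.⊕ y)) MS.⊜ (u MS.⊕ x) MS.⊕ (v MS.⊕ y)) refl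
        pq-supp : ∀ {s} → (p ⊕ q) s ≉ 0# → φ s ≉ 0#
        pq-supp = ≉-resp (sym (φ≈ _))
        p-supp : ∀ {s} → p s ≉ 0# → s ≢ 0 → M < s ℕ.+ s
        p-supp pₛ s≢0 with ⊕-supp (mono E₁.unit 0) hi pₛ
        ... | inj₁ mono≉0 = contradiction (mono-supp E₁.unit 0 mono≉0) s≢0
        ... | inj₂ hi≉0 = proj₁ (↾-supp E₂.rest high? hi≉0)
        q-supp : ∀ {s} → q s ≉ 0# → s ≢ M → s ℕ.+ s ℕ.≤ M
        q-supp qₛ s≢M with ⊕-supp (mono E₂.unit M) lo qₛ
        ... | inj₁ mono≉0 = contradiction (mono-supp E₂.unit M mono≉0) s≢M
        ... | inj₂ lo≉0 = ℕ.≮⇒≥ (proj₁ (↾-supp E₂.rest (¬? ∘ high?) lo≉0))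
        p-atom : AdditiveAtom (p 0)
        p-atom = atom-+ˡ (atom-resp (sym (mono-at E₁.unit 0)) E₁.unit-atom)
          λ hi≉0 → ℕ.n≮0 (proj₁ (↾-supp E₂.rest high? hi≉0))
        q-atom : AdditiveAtom (q M)
        q-atom = atom-+ˡ (atom-resp (sym (mono-at E₂.unit M)) E₂.unit-atom)
          λ lo≉0 → 2M≰M (ℕ.≮⇒≥ (proj₁ (↾-supp E₂.rest (¬? ∘ high?) lo≉0)))
        result : SumOfThree φ
        result with other? p 0 | other? q M
        ... | inj₁ (i , i≢0 , pᵢ) | inj₁ (j , j≢M , qⱼ) = sum₂ P Q φ≈
          where
          P : IrreducibleSeq p
          P = upper⇒irreducible {M = M} p-atom p-supp (≤M ∘ pq-supp ∘ +≉0ˡ) pᵢ i≢0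
          Q : IrreducibleSeq q
          Q = distant⇒irreducible q-atom qⱼ j≢M q-supp
            λ _ qₛ _ 2s≡M → contradiction (pq-supp (+≉0ʳ qₛ)) (no-middle 2s≡M)
        ... | inj₂ p-mono | _ = sum₁ PQ φ≈
          where
          supp : ∀ {s} → (p ⊕ q) s ≉ 0# → s ≢ M → s ℕ.+ s ℕ.≤ M
          supp {s} ≉0 s≢M with ⊕-supp p q ≉0
          ... | inj₁ pₛ with ≡.refl ← p-mono pₛ = ℕ.z≤n
          ... | inj₂ qₛ = q-supp qₛ s≢M
          PQ : IrreducibleSeq (p ⊕ q)
          PQ = distant⇒irreducible (atom-+ʳ (M≢0 ∘ p-mono) q-atom) (+≉0ˡ (atom≉0 p-atom)) (M≢0 ∘ ≡.sym) supp
            λ _ ≉0 _ 2s≡M → contradiction (pq-supp ≉0) (no-middle 2s≡M)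
        ... | inj₁ _ | inj₂ q-mono = sum₁ PQ φ≈
          where
          supp : ∀ {s} → (p ⊕ q) s ≉ 0# → s ≢ 0 → M < s ℕ.+ s
          supp {s} ≉0 s≢0 with ⊕-supp p q ≉0
          ... | inj₁ pₛ = p-supp pₛ s≢0
          ... | inj₂ qₛ with ≡.refl ← q-mono qₛ = ℕ.≰⇒> 2M≰M
          PQ : IrreducibleSeq (p ⊕ q)
          PQ = upper⇒irreducible {M = M} (atom-+ˡ p-atom (M≢0 ∘ ≡.sym ∘ q-mono)) supp (≤M ∘ pq-supp)
            (+≉0ʳ (atom≉0 q-atom)) M≢0

      middle⇒sumOfThree : ∀ {h} → h ℕ.+ h ≡ M → Extraction E₂.rest h → SumOfThree φ
      middle⇒sumOfThree {h} 2h≡M E₃ = result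
        where
        module E₃ = Extraction E₃
        high? : ∀ k → Dec (M < k ℕ.+ k)
        high? k = M ℕ.<? k ℕ.+ k
        hi = E₃.rest ↾ high?
        low = E₃.rest ↾ (¬? ∘ high?)
        z = low ↾ (ℕ._≟ 0)
        lo = low ↾ (¬? ∘ (ℕ._≟ 0))
        p = mono E₁.unit 0 ⊕ hi
        q = mono E₂.unit M ⊕ lo
        r = mono E₃.unit h ⊕ z
        φ≈ : ∀ k → φ k ≈ p k + (q k + r k)
        φ≈ k = trans (E₁.split k) (trans (+-congˡ (trans (E₂.split k) (+-congˡ (trans (E₃.split k)
          (+-congˡ (trans (↾-split E₃.rest high? k) (+-congˡ (↾-split low (ℕ._≟ 0) k))))))))
          (regroup (mono E₁.unit 0 k) (mono E₂.unit M k) (mono E₃.unit h k) (hi k) (z k) (lo k)))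
          where
          regroup : ∀ u v w x y z → u + (v + (w + (x + (y + z)))) ≈ (u + x) + ((v + z) + (w + y))
          regroup = MS.solve 6 (λ u v w x y z → u MS.⊕ (v MS.⊕ (w MS.⊕ (x MS.⊕ (y MS.⊕ z))))
            MS.⊜ (u MS.⊕ x) MS.⊕ ((v MS.⊕ z) MS.⊕ (w MS.⊕ y))) refl
        h≢0 : h ≢ 0
        h≢0 ≡.refl = M≢0 (≡.sym 2h≡M)
        h≢M : h ≢ M
        h≢M ≡.refl = 2M≰M (ℕ.≤-reflexive 2h≡M)
        p-supp : ∀ {s} → p s ≉ 0# → s ≢ 0 → M < s ℕ.+ s
        p-supp pₛ s≢0 with ⊕-supp (mono E₁.unit 0) hi pₛ
        ... | inj₁ mono≉0 = contradiction (mono-supp E₁.unit 0 mono≉0) s≢0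
        ... | inj₂ hi≉0 = proj₁ (↾-supp E₃.rest high? hi≉0)
        lo-supp : ∀ {s} → lo s ≉ 0# → s ≢ 0 × s ℕ.+ s ℕ.≤ M
        lo-supp lo≉0 with s≢0 , low≉0 ← ↾-supp low (¬? ∘ (ℕ._≟ 0)) lo≉0 =
          s≢0 , ℕ.≮⇒≥ (proj₁ (↾-supp E₃.rest (¬? ∘ high?) low≉0))
        q-supp : ∀ {s} → q s ≉ 0# → s ≢ M → s ℕ.+ s ℕ.≤ M
        q-supp qₛ s≢M with ⊕-supp (mono E₂.unit M) lo qₛ
        ... | inj₁ mono≉0 = contradiction (mono-supp E₂.unit M mono≉0) s≢M
        ... | inj₂ lo≉0 = proj₂ (lo-supp lo≉0)
        q₀ : ¬ q 0 ≉ 0#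
        q₀ ≉0 with ⊕-supp (mono E₂.unit M) lo ≉0
        ... | inj₁ mono≉0 = M≢0 (≡.sym (mono-supp E₂.unit M mono≉0))
        ... | inj₂ lo≉0 = proj₁ (lo-supp lo≉0) ≡.refl
        r-supp : ∀ {s} → r s ≉ 0# → s ≢ h → s ≡ 0
        r-supp rₛ s≢h with ⊕-supp (mono E₃.unit h) z rₛ
        ... | inj₁ mono≉0 = contradiction (mono-supp E₃.unit h mono≉0) s≢h
        ... | inj₂ z≉0 = proj₁ (↾-supp low (ℕ._≟ 0) z≉0)
        rM : ¬ r M ≉ 0#
        rM ≉0 = M≢0 (r-supp ≉0 (h≢M ∘ ≡.sym))
        ph : ¬ p h ≉ 0#
        ph ≉0 = ℕ.<⇒≢ (p-supp ≉0 h≢0) (≡.sym 2h≡M)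
        p-atom : AdditiveAtom (p 0)
        p-atom = atom-+ˡ (atom-resp (sym (mono-at E₁.unit 0)) E₁.unit-atom)
          λ hi≉0 → ℕ.n≮0 (proj₁ (↾-supp E₃.rest high? hi≉0))
        q-atom : AdditiveAtom (q M)
        q-atom = atom-+ˡ (atom-resp (sym (mono-at E₂.unit M)) E₂.unit-atom) (2M≰M ∘ proj₂ ∘ lo-supp)
        r-atom : AdditiveAtom (r h)
        r-atom = atom-+ˡ (atom-resp (sym (mono-at E₃.unit h)) E₃.unit-atom) (h≢0 ∘ proj₁ ∘ ↾-supp low (ℕ._≟ 0))
        half≡h : ∀ {s} → s ℕ.+ s ≡ M → s ≡ h
        half≡h {s} 2s≡M = ℕ.*-cancelʳ-≡ s h 2
          (≡.trans (double s) (≡.trans 2s≡M (≡.trans (≡.sym 2h≡M) (≡.sym (double h)))))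
          where
          double : ∀ s → s ℕ.* 2 ≡ s ℕ.+ s
          double = ℕ.solve-∀
        p≤M : ∀ {s} → p s ≉ 0# → s ℕ.≤ M
        p≤M pₛ = ≤M (≉-resp (sym (φ≈ _)) (+≉0ˡ pₛ))

        p-irreducible : ∀ {m} → m ≢ 0 → p m ≉ 0# → IrreducibleSeq p
        p-irreducible m≢0 pₘ = upper⇒irreducible {M = M} p-atom p-supp p≤M pₘ m≢0

        q-irreducible : ∀ {m} → m ≢ M → q m ≉ 0# → IrreducibleSeq q
        q-irreducible m≢M qₘ = distant⇒irreducible q-atom qₘ m≢M q-supp λ q₀≉0 → contradiction q₀≉0 q₀

        h-distant : ∀ {ψ} → AdditiveAtom (ψ h) → ψ 0 ≉ 0# → (∀ {s} → ψ s ≉ 0# → s ≢ h → s ≡ 0) → IrreducibleSeq ψ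
        h-distant {ψ} at ψ₀ supp = distant⇒irreducible {ψ} {0} {h} at ψ₀ (h≢0 ∘ ≡.sym)
          (λ ψₛ s≢h → subst (λ s → s ℕ.+ s ℕ.≤ h) (≡.sym (supp ψₛ s≢h)) ℕ.z≤n)
          λ _ ψₛ s≢h 2s≡h → contradiction (≡.trans (≡.sym 2s≡h) (cong₂ ℕ._+_ (supp ψₛ s≢h) (supp ψₛ s≢h))) h≢0

        r-irreducible : ∀ {m} → m ≢ h → r m ≉ 0# → IrreducibleSeq r
        r-irreducible m≢h rₘ = h-distant r-atom (subst (λ m → r m ≉ 0#) (r-supp rₘ m≢h) rₘ) r-supp

        p⊕q-irreducible : (∀ {m} → q m ≉ 0# → m ≡ M) → IrreducibleSeq (p ⊕ q)
        p⊕q-irreducible q-mono = upper⇒irreducible {M = M} (atom-+ˡ p-atom q₀) upper ≤M′ (+≉0ʳ (atom≉0 q-atom)) M≢0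
          where
          upper : ∀ {s} → (p ⊕ q) s ≉ 0# → s ≢ 0 → M < s ℕ.+ s
          upper ≉0 s≢0 with ⊕-supp p q ≉0
          ... | inj₁ pₛ = p-supp pₛ s≢0
          ... | inj₂ qₛ with ≡.refl ← q-mono qₛ = ℕ.≰⇒> 2M≰M
          ≤M′ : ∀ {s} → (p ⊕ q) s ≉ 0# → s ℕ.≤ M
          ≤M′ = [ p≤M , ℕ.≤-reflexive ∘ q-mono ]′ ∘ ⊕-supp p q

        p⊕r-irreducible : (∀ {m} → p m ≉ 0# → m ≡ 0) → IrreducibleSeq (p ⊕ r)
        p⊕r-irreducible p-mono = h-distant (atom-+ʳ ph r-atom) (+≉0ˡ (atom≉0 p-atom)) supp
          where
          supp : ∀ {s} → (p ⊕ r) s ≉ 0# → s ≢ h → s ≡ 0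
          supp ≉0 s≢h = [ p-mono , (λ rₛ → r-supp rₛ s≢h) ]′ (⊕-supp p r ≉0)

        q⊕r-supp : (∀ {m} → r m ≉ 0# → m ≡ h) → ∀ {s} → (q ⊕ r) s ≉ 0# → s ≢ M → s ℕ.+ s ℕ.≤ M
        q⊕r-supp r-mono ≉0 s≢M with ⊕-supp q r ≉0
        ... | inj₁ qₛ = q-supp qₛ s≢M
        ... | inj₂ rₛ with ≡.refl ← r-mono rₛ = ℕ.≤-reflexive 2h≡M

        q⊕r-irreducible : (∀ {m} → r m ≉ 0# → m ≡ h) → IrreducibleSeq (q ⊕ r)
        q⊕r-irreducible r-mono = distant⇒irreducible (atom-+ˡ q-atom rM) (+≉0ʳ (atom≉0 r-atom)) h≢M (q⊕r-supp r-mono)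
          λ ≉0 → ⊥-elim ([ q₀ , h≢0 ∘ ≡.sym ∘ r-mono ]′ (⊕-supp q r ≉0))

        p⊕q⊕r-irreducible : (∀ {m} → p m ≉ 0# → m ≡ 0) → (∀ {m} → q m ≉ 0# → m ≡ M) →
          (∀ {m} → r m ≉ 0# → m ≡ h) → IrreducibleSeq (p ⊕ (q ⊕ r))
        p⊕q⊕r-irreducible p-mono q-mono r-mono = distant⇒irreducible {M = M}
          (atom-+ʳ (M≢0 ∘ p-mono) (atom-+ˡ q-atom rM)) (+≉0ˡ (atom≉0 p-atom)) (M≢0 ∘ ≡.sym) supp
          λ {s} _ _ _ 2s≡M → subst (λ s → AdditiveAtom ((p ⊕ (q ⊕ r)) s)) (≡.sym (half≡h {s} 2s≡M))
            (atom-+ʳ ph (atom-+ʳ (h≢M ∘ q-mono) r-atom))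
          where
          supp : ∀ {s} → (p ⊕ (q ⊕ r)) s ≉ 0# → s ≢ M → s ℕ.+ s ℕ.≤ M
          supp ≉0 s≢M with ⊕-supp p (q ⊕ r) ≉0
          ... | inj₁ pₛ with ≡.refl ← p-mono pₛ = ℕ.z≤n
          ... | inj₂ qrₛ = q⊕r-supp r-mono qrₛ s≢M

        φ≈pq+r : ∀ k → φ k ≈ (p ⊕ q) k + r k
        φ≈pq+r k = trans (φ≈ k) (sym (+-assoc (p k) (q k) (r k)))
        φ≈pr+q : ∀ k → φ k ≈ (p ⊕ r) k + q k
        φ≈pr+q k = trans (φ≈ k) (trans (+-congˡ (+-comm (q k) (r k))) (sym (+-assoc (p k) (r k) (q k))))

        result : SumOfThree φ
        result with other? p 0 | other? q M | other? r h
        ... | _ | inj₂ q-mono | inj₁ (_ , k≢h , rₖ) = sum₂ (p⊕q-irreducible q-mono) (r-irreducible k≢h rₖ) φ≈pq+r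
        ... | inj₁ (_ , i≢0 , pᵢ) | inj₁ (_ , j≢M , qⱼ) | inj₁ (_ , k≢h , rₖ) =
          sum₃ (p-irreducible i≢0 pᵢ) (q-irreducible j≢M qⱼ) (r-irreducible k≢h rₖ) φ≈
        ... | inj₂ p-mono | inj₁ (_ , j≢M , qⱼ) | _ = sum₂ (p⊕r-irreducible p-mono) (q-irreducible j≢M qⱼ) φ≈pr+q
        ... | inj₁ (_ , i≢0 , pᵢ) | _ | inj₂ r-mono = sum₂ (p-irreducible i≢0 pᵢ) (q⊕r-irreducible r-mono) φ≈
        ... | inj₂ p-mono | inj₂ q-mono | inj₂ r-mono = sum₁ (p⊕q⊕r-irreducible p-mono q-mono r-mono) φ≈

    finite⇒sumOfThree : ∀ {φ i} → φ 0 ≉ 0# → φ i ≉ 0# → i ≢ 0 → Finite φ → SumOfThree φ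
    finite⇒sumOfThree {φ} {i} φ₀ φᵢ i≢0 fin with greatest φ φᵢ fin
    ... | M , φM , ≤M = result
      where
      M≢0 : M ≢ 0
      M≢0 ≡.refl = i≢0 (ℕ.n≤0⇒n≡0 (≤M φᵢ))
      E₁ = extract φ 0 φ₀
      E₂ = extract (Extraction.rest E₁) M (Extraction.keep E₁ M≢0 φM)
      result : SumOfThree φ
      result with em {∃[ h ] h ℕ.+ h ≡ M × φ h ≉ 0#}
      ... | no none = no-middle⇒sumOfThree M≢0 ≤M E₁ E₂ λ {h} 2h≡M φₕ → none (h , 2h≡M , φₕ)
      ... | yes (h , 2h≡M , φₕ) = middle⇒sumOfThree M≢0 ≤M E₁ E₂ {h} 2h≡M
        (extract (Extraction.rest E₂) h (Extraction.keep E₂ h≢M (Extraction.keep E₁ h≢0 φₕ)))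
        where
        h≢0 : h ≢ 0
        h≢0 ≡.refl = M≢0 (≡.sym 2h≡M)
        h≢M : h ≢ M
        h≢M ≡.refl = M≢0 (ℕ.+-cancelˡ-≡ M M 0 (≡.trans 2h≡M (≡.sym (ℕ.+-identityʳ M))))

    order0⇒sumOfThree : ∀ {φ i} → φ 0 ≉ 0# → φ i ≉ 0# → i ≢ 0 → SumOfThree φ
    order0⇒sumOfThree {φ} φ₀ φᵢ i≢0 = [ finite⇒sumOfThree φ₀ φᵢ i≢0 , infinite⇒sumOfThree φ₀ ]′ (finite? φ)

  normalise : ∀ f → ∣supp∣>1 f → ∃[ b ] ∃[ φ ] ∃[ i ] φ 0 ≉ 0# × φ i ≉ 0# × i ≢ 0 × f ≋ series b φ
  normalise f (i , j , i≢j , fᵢ , fⱼ)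
    with p , ≡.refl ← above f {i} fᵢ | q , ≡.refl ← above f {j} fⱼ
    with l , fₗ , lead ← least {λ k → coeff f (bound f ℤ.+ + k) ≉ 0#} p fᵢ = second (p ℕ.≟ l) (q ℕ.≟ l)
    where
    b = bound f ℤ.+ + l
    φ : Seq
    φ k = coeff f (b ℤ.+ + k)
    φ₀ : φ 0 ≉ 0#
    φ₀ = ≉-resp-≡ (cong (coeff f) (≡.sym (ℤ.+-identityʳ b))) fₗ
    reindex : ∀ {k} → coeff f (bound f ℤ.+ + k) ≉ 0# → φ (k ℕ.∸ l) ≉ 0#
    reindex {k} fₖ = ≉-resp-≡ (cong (coeff f) (≡.sym (≡.trans (ℤ.+-assoc (bound f) (+ l) (+ (k ℕ.∸ l)))
      (cong (λ m → bound f ℤ.+ + m) (ℕ.m+[n∸m]≡n (lead fₖ)))))) fₖ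
    f≋ : f ≋ series b φ
    f≋ n = at (n ℤ.- b) ≡.refl
      where
      cancel : ∀ b n → n ≡ b ℤ.+ (n ℤ.- b)
      cancel = solve-∀
      n≡ : ∀ {d} → n ℤ.- b ≡ d → n ≡ b ℤ.+ d
      n≡ eq = ≡.trans (cancel b n) (cong (ℤ._+_ b) eq)
      at : ∀ d → n ℤ.- b ≡ d → coeff f n ≈ Series.extend b φ d
      at (+ k) eq = reflexive (cong (coeff f) (n≡ eq))
      at -[1+ k ] eq = stable λ fₙ → absurd fₙ (above f {n} fₙ)
        where
        absurd : coeff f n ≉ 0# → ∃[ m ] n ≡ bound f ℤ.+ + m → ⊥
        absurd fₙ (m , ≡.refl) with () ← ℤ+.∙-cancelˡ b _ _ (≡.trans (≡.sym (n≡ eq))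
          (≡.trans (cong (λ m → bound f ℤ.+ + m) (≡.sym (ℕ.m+[n∸m]≡n (lead fₙ))))
            (≡.sym (ℤ.+-assoc (bound f) (+ l) (+ (m ℕ.∸ l))))))
    second : Dec (p ≡ l) → Dec (q ≡ l) → ∃[ b ] ∃[ φ ] ∃[ i ] φ 0 ≉ 0# × φ i ≉ 0# × i ≢ 0 × f ≋ series b φ
    second (no p≢l) _ = b , φ , p ℕ.∸ l , φ₀ , reindex fᵢ ,
      (λ p∸l≡0 → p≢l (ℕ.≤-antisym (ℕ.m∸n≡0⇒m≤n p∸l≡0) (lead fᵢ))) , f≋
    second (yes _) (no q≢l) = b , φ , q ℕ.∸ l , φ₀ , reindex fⱼ ,
      (λ q∸l≡0 → q≢l (ℕ.≤-antisym (ℕ.m∸n≡0⇒m≤n q∸l≡0) (lead fⱼ))) , f≋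
    second (yes ≡.refl) (yes ≡.refl) = contradiction ≡.refl i≢j

  nonzero⇒atom+rest : AdditivelyAtomic → ∀ {x} → x ≉ 0# → ∃[ u ] ∃[ y ] AdditiveAtom u × x ≈ u + y
  nonzero⇒atom+rest atomic {x} x≉0 with atomic x (x≉0 ∘ reduced x)
  ... | ℕ.zero , _ , _ , x≈0 = contradiction x≈0 x≉0
  ... | ℕ.suc n , as , atoms , x≈Σ = as Fin.zero , sum (as ∘ Fin.suc) , atoms Fin.zero , x≈Σ

  -- Multiplication by a unit is an automorphism of (S,+), so one unit atom makes every unit an atom.
  unit⇒atom : ∀ {u v} → AdditiveAtom u → MultiplicativeUnit u → MultiplicativeUnit v → AdditiveAtom v
  unit⇒atom {u} {v} at (u⁻¹ , u⁻¹u≈1) (v⁻¹ , v⁻¹v≈1) = mkAtom v≉0 split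
    where
    c = u * v⁻¹
    v≉0 : v ≉ 0#
    v≉0 = *≉0⇒ʳ (≉-resp (sym v⁻¹v≈1) 1≉0)
    c≉0 : c ≉ 0#
    c≉0 = *≉0 (atom≉0 at) (*≉0⇒ˡ (≉-resp (sym v⁻¹v≈1) 1≉0))
    split : ∀ {y z} → v ≈ y + z → y ≈ 0# ⊎ z ≈ 0#
    split {y} {z} v≈ with atom-split at (trans (sym (*-identityʳ u)) (trans (*-congˡ (sym v⁻¹v≈1))
      (trans (sym (*-assoc u v⁻¹ v)) (trans (*-congˡ v≈) (distribˡ c y z)))))
    ... | inj₁ cy≈0 = inj₁ (stable λ y≉0 → *≉0 c≉0 y≉0 cy≈0)
    ... | inj₂ cz≈0 = inj₂ (stable λ z≉0 → *≉0 c≉0 z≉0 cz≈0)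

  atoms⊆units⇒sumOfThree : AdditivelyAtomic → (∀ {x} → AdditiveAtom x → MultiplicativeUnit x) →
    ∀ f → ∣supp∣>1 f → S⟦x⟧.SumOfAtMost 3 Irreducibles f
  atoms⊆units⇒sumOfThree atomic atom⇒unit f >1 =
    let b , φ , i , φ₀ , φᵢ , i≢0 , f≋φ = normalise f >1
        open Decompose atom⇒unit (nonzero⇒atom+rest atomic)
        n , n≤3 , hs , irr , φ≋Σ = SumOfThree.sumOfThree (order0⇒sumOfThree {φ} {i} φ₀ φᵢ i≢0) b
    in n , n≤3 , hs , irr , λ d → trans (f≋φ d) (φ≋Σ d)

  bounded⇒atoms≐units : AdditivelyAtomic → ∀ {k} → (∀ f → ∣supp∣>1 f → S⟦x⟧.SumOfAtMost k Irreducibles f) →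
    AdditiveAtom ≐ MultiplicativeUnit
  bounded⇒atoms≐units atomic bounded = atom⇒unit , unit⇒atom at (atom⇒unit at)
    where
    atom⇒unit : ∀ {x} → AdditiveAtom x → MultiplicativeUnit x
    atom⇒unit = Bounded.atom⇒unit bounded
    at = proj₁ (proj₂ (proj₂ (nonzero⇒atom+rest atomic 1≉0)))

theorem4p4 : ∀ {c ℓ p : Level} → ExcludedMiddle (c ⊔ ℓ ⊔ p) →
    (S : Semidomain c ℓ p) → IsAdditivelyReduced S → IsAdditivelyAtomic S →
    (AtomsEqualUnits S ⇔ EverySeriesSumOfAtMost S 3)
    × (EverySeriesSumOfAtMost S 3 ⇔ (∃[ k ] 0 < k × EverySeriesSumOfAtMost S k))
theorem4p4 {c} {ℓ} {p} em S reduced atomic =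
  mk⇔ (λ (atom⇒unit , _) → three atom⇒unit) atoms≐units ,
  mk⇔ (λ three → 3 , s≤s ℕ.z≤n , three) (λ (k , _ , bounded) → three (proj₁ (atoms≐units bounded)))
  where
  module S = Semidomain S
  em′ : ExcludedMiddle ℓ
  em′ {P} = map′ lower lift (em {Lift (c ⊔ p) P})
  open Reduced S.commutativeSemiring em′ reduced
    (IntegralDomain.1≉0 S.integralDomain) (IntegralDomain.noZeroDivisors S.integralDomain)
  three = atoms⊆units⇒sumOfThree atomic
  atoms≐units : ∀ {k} → EverySeriesSumOfAtMost S k → AtomsEqualUnits S
  atoms≐units = bounded⇒atoms≐units atomic
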